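{- For each $a\in\{0,1,2\}$, the set $\left\{\frac{n}{3^{\lfloor\|n\|/3\rfloor}}: \|n\|\equiv a\pmod 3,\ n \text{ stable}\right\}$ is reverse well-ordered (well-ordered under the reverse of the usual order on $\mathbb{R}$), with reverse order type $\omega^\omega$. Equivalently, for each $a\in\{0,1,2\}$ the same holds for the set $\left\{\frac{n}{E(\|n\|)}: \|n\|\equiv a\pmod 3,\ n\text{ stable}\right\}$.
   Context: $\|n\|$ is the complexity of a positive integer $n$: the least number of $1$'s needed to write $n$ using $1$, $+$, $\times$ and parentheses. A positive integer $n$ is stable if $\|3^kn\|=3k+\|n\|$ for all $k\ge1$. $E(k)$ denotes the largest positive integer of complexity at most $k$. -}

module Defs where

open import Data.Nat using (ℕ; zero; suc; _+_; _*_; _^_; _≤_; _<_; _≥_; _/_; _%_)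
open import Data.Integer using (+_)
open import Data.Rational as ℚ using (ℚ; 0ℚ)
open import Data.List using (List; []; _∷_)
open import Data.List.Relation.Unary.Linked using (Linked)
open import Data.Product using (Σ; ∃; _×_; proj₁)
open import Function.Bundles using (_⇔_)
open import Induction.WellFounded using (WellFounded)
open import Relation.Binary.PropositionalEquality using (_≡_)

data Expr : Set where
  one : Expr
  _⊕_ : Expr → Expr → Expr
  _⊗_ : Expr → Expr → Expr

eval : Expr → ℕ
eval one = 1
eval (e ⊕ f) = eval e + eval f
eval (e ⊗ f) = eval e * eval f

ones : Expr → ℕ
ones one = 1
ones (e ⊕ f) = ones e + ones f
ones (e ⊗ f) = ones e + ones f

Cpx : ℕ → ℕ → Set
Cpx n k = (Σ Expr λ e → eval e ≡ n × ones e ≡ k) × (∀ e → eval e ≡ n → k ≤ ones e)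

Stable : ℕ → Set
Stable n = ∀ c → Cpx n c → ∀ k → k ≥ 1 → Cpx (3 ^ k * n) (3 * k + c)

IsE : ℕ → ℕ → Set
IsE k m = (Σ Expr λ e → eval e ≡ m × ones e ≤ k) × (∀ e → ones e ≤ k → eval e ≤ m)

-- n / m as a rational (denominator 0 never occurs in use; mapped to 0 by convention)
frac : ℕ → ℕ → ℚ
frac n zero = 0ℚ
frac n (suc m) = (+ n) ℚ./ suc m

S₃ : ℕ → ℚ → Set
S₃ a q = ∃ λ n → ∃ λ k → Cpx n k × k % 3 ≡ a × Stable n × q ≡ frac n (3 ^ (k / 3))

SE : ℕ → ℚ → Set
SE a q = ∃ λ n → ∃ λ k → ∃ λ m → Cpx n k × IsE k m × k % 3 ≡ a × Stable n × q ≡ frac n m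

-- Concrete model of the ordinal ω^ω: Cantor normal forms
-- ω^{k₁} + … + ω^{kᵣ} with k₁ ≥ … ≥ kᵣ, as non-increasing lists, ordered lexicographically.
CNF : Set
CNF = Σ (List ℕ) (Linked (λ x y → y ≤ x))

data _<ω_ : List ℕ → List ℕ → Set where
  []<∷  : ∀ {y ys} → [] <ω (y ∷ ys)
  head< : ∀ {x y xs ys} → x < y → (x ∷ xs) <ω (y ∷ ys)
  tail< : ∀ {x xs ys} → xs <ω ys → (x ∷ xs) <ω (x ∷ ys)

ReverseWellOrdered : (ℚ → Set) → Set
ReverseWellOrdered P = WellFounded _>ₚ_
  where
  _>ₚ_ : Σ ℚ P → Σ ℚ P → Set
  x >ₚ y = proj₁ y ℚ.< proj₁ x

-- (P, ≥) is order-isomorphic to ω^ω: a surjective map to CNF that turns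
-- the reverse order on P into the ordinal order (hence is an order isomorphism).
ReverseOrderTypeωω : (ℚ → Set) → Set
ReverseOrderTypeωω P =
  Σ (Σ ℚ P → CNF) λ f →
    (∀ x y → (proj₁ y ℚ.< proj₁ x) ⇔ (proj₁ (f x) <ω proj₁ (f y)))
    × (∀ (c : CNF) → Σ (Σ ℚ P) λ x → proj₁ (f x) ≡ proj₁ c)

{-# OPTIONS --safe #-}
-- Extend the stable complexity to triadic numbers by c(3x) = c(x) + 3.  The set of the theorem is
-- then S(a) = { x : c(x) = a }, up to a constant factor for the second form.  Put T(b) = { x : c(x) ≤ b }.
-- Above any positive bound, T(b) is built from points by finitely many unions, products and additions
-- of m / 3^j with m bounded and j arbitrary; the last operation adds limit points, approached from
-- above only, and costs at least one.  The construction terminates because the defect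
-- b - 3 log₃ x drops by at least 2 - 3 log₃ 2 at every step.  Conversely x + 3^-j lies in T(b + 1)
-- for x in T(b) and large j.  So T(b) has a greatest element below any positive number, this element
-- lies in S(b), and the Cantor–Bendixson rank of x in T(a) is a - c(x).  The position of x in S(a) is
-- read off from the y > x in T(a) with c(y) ≤ c(z) for all z in T(a) between x and y: in decreasing
-- order, their ranks a - c(y) are the exponents of its Cantor normal form.
module Submission where

open import Defs
open import Data.Empty using (⊥; ⊥-elim)
open import Data.Fin using (Fin; toℕ; #_)
open import Data.Fin.Properties using (all?)
import Data.Integer as ℤ
import Data.Integer.Properties as ℤₚ
open import Data.List using (List; []; _∷_; _++_; cartesianProductWith)
open import Data.List.Membership.Propositional using (_∈_)
open import Data.List.Membership.Propositional.Properties using (∈-++⁺ˡ; ∈-++⁺ʳ; ∈-cartesianProductWith⁺)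
open import Data.List.Relation.Unary.Any using (here; there)
open import Data.List.Relation.Unary.Linked using (Linked; []; [-]; _∷_; tail)
open import Data.Nat
open import Data.Nat.Divisibility using (divides)
open import Data.Nat.DivMod using (m≡m%n+[m/n]*n; [m+kn]%n≡m%n; m<n⇒m%n≡m; +-distrib-/-∣ʳ; m*n/n≡m; m<n⇒m/n≡0)
open import Data.Nat.Properties
open import Data.Nat.Tactic.RingSolver using (solve-∀)
open import Algebra.Properties.CommutativeSemigroup *-commutativeSemigroup
  using (interchange; xy∙z≈xz∙y; x∙yz≈y∙xz)
open import Data.Product using (Σ; ∃; _×_; _,_; proj₁; proj₂)
open import Data.Rational using (ℚ)
import Data.Rational as ℚ
import Data.Rational.Properties as ℚₚ
import Data.Rational.Unnormalised as ℚᵘ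
open import Data.Rational.Unnormalised using (mkℚᵘ; *<*)
import Data.Rational.Unnormalised.Properties as ℚᵘₚ
open import Data.Sum using (_⊎_; inj₁; inj₂; [_,_]′)
open import Function.Bundles using (_⇔_; mk⇔; Equivalence)
open import Induction.WellFounded using (Acc; acc)
open import Relation.Binary.Definitions using (tri<; tri≈; tri>)
open import Relation.Binary.PropositionalEquality using (_≡_; refl; sym; trans; cong; cong₂; subst; subst₂)
open import Relation.Nullary using (¬_; yes; no)
open import Relation.Nullary.Decidable using (from-yes)

-- Membership in `T β` asks for a witness at some level, and no bound on that level is known, so it
-- is never decided. Instead, `T β` above a positive bound is covered by an explicit tree of points
-- and limit points lying in `T β`, and greatest elements are computed from this tree alone. The
-- bound must be positive because `T β` has arbitrarily small elements. An expression has defect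
-- zero only if its value is a power of 3 and its cost is optimal; all other defects are at least
-- that of 2. This gap is the unit in which the descent is counted. Factors of defect zero would
-- make no progress, so they are stripped first and only shift the level. The addend m is bounded
-- for this reason: adding a number no larger than the other summand at most doubles the value,
-- while the cost of the addend goes entirely into the defect, which is bounded above a positive
-- bound. Higher rank means lower complexity, possibly a negative one. The index `β`, standing for 2
-- - b, keeps all this in natural numbers; 2 is the largest residue modulo 3.

3^≢0 : ∀ n → NonZero (3 ^ n)
3^≢0 n = m^n≢0 3 n

n<3^n : ∀ n → n < 3 ^ n
n<3^n zero = z<s
n<3^n (suc n) = begin-strict
  suc n            <⟨ s≤s (n<3^n n) ⟩
  1 + 3 ^ n        ≤⟨ +-monoˡ-≤ (3 ^ n) (m^n>0 3 n) ⟩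
  3 ^ n + 3 ^ n    ≤⟨ m≤m+n _ _ ⟩
  (3 ^ n + 3 ^ n) + 3 ^ n ≡⟨ lem (3 ^ n) ⟩
  3 * 3 ^ n ∎
  where
  open ≤-Reasoning
  lem : ∀ a → (a + a) + a ≡ 3 * a
  lem = solve-∀

-- Triadic numbers

infix 5 _/3^_
record Triadic : Set where
  constructor _/3^_
  field
    num lev : ℕ
open Triadic

-- Records rather than plain definitions, so that x and y can be inferred from a proof.
infix 4 _≼_ _≺_ _≋_
record _≼_ (x y : Triadic) : Set where
  constructor le
  field cross : num x * 3 ^ lev y ≤ num y * 3 ^ lev x

record _≺_ (x y : Triadic) : Set where
  constructor lt
  field cross : num x * 3 ^ lev y < num y * 3 ^ lev x

record _≋_ (x y : Triadic) : Set where
  constructor eq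
  field cross : num x * 3 ^ lev y ≡ num y * 3 ^ lev x

-- Transitivity for the fractions A/p, B/q, C/r with cross-multiplied comparisons.
module _ {A B C p q r : ℕ} .{{_ : NonZero q}} where
  open ≤-Reasoning

  fraction-≤-trans : A * q ≤ B * p → B * r ≤ C * q → A * r ≤ C * p
  fraction-≤-trans h k = *-cancelʳ-≤ (A * r) (C * p) q (begin
    A * r * q ≡⟨ xy∙z≈xz∙y A r q ⟩
    A * q * r ≤⟨ *-monoˡ-≤ r h ⟩
    B * p * r ≡⟨ xy∙z≈xz∙y B p r ⟩
    B * r * p ≤⟨ *-monoˡ-≤ p k ⟩
    C * q * p ≡⟨ xy∙z≈xz∙y C q p ⟩
    C * p * q ∎)

  fraction-<-≤-trans : .{{_ : NonZero r}} → A * q < B * p → B * r ≤ C * q → A * r < C * p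
  fraction-<-≤-trans h k = *-cancelʳ-< q (A * r) (C * p) (begin-strict
    A * r * q ≡⟨ xy∙z≈xz∙y A r q ⟩
    A * q * r <⟨ *-monoˡ-< r h ⟩
    B * p * r ≡⟨ xy∙z≈xz∙y B p r ⟩
    B * r * p ≤⟨ *-monoˡ-≤ p k ⟩
    C * q * p ≡⟨ xy∙z≈xz∙y C q p ⟩
    C * p * q ∎)

  fraction-≤-<-trans : .{{_ : NonZero p}} → A * q ≤ B * p → B * r < C * q → A * r < C * p
  fraction-≤-<-trans h k = *-cancelʳ-< q (A * r) (C * p) (begin-strict
    A * r * q ≡⟨ xy∙z≈xz∙y A r q ⟩
    A * q * r ≤⟨ *-monoˡ-≤ r h ⟩
    B * p * r ≡⟨ xy∙z≈xz∙y B p r ⟩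
    B * r * p <⟨ *-monoˡ-< p k ⟩
    C * q * p ≡⟨ xy∙z≈xz∙y C q p ⟩
    C * p * q ∎)

≼-trans : ∀ {x y z} → x ≼ y → y ≼ z → x ≼ z
≼-trans {x} {y} {z} (le h) (le k) = le (fraction-≤-trans {num x} {num y} {num z} {{3^≢0 (lev y)}} h k)

≺-≼-trans : ∀ {x y z} → x ≺ y → y ≼ z → x ≺ z
≺-≼-trans {x} {y} {z} (lt h) (le k) =
  lt (fraction-<-≤-trans {num x} {num y} {num z} {{3^≢0 (lev y)}} {{3^≢0 (lev z)}} h k)

≼-≺-trans : ∀ {x y z} → x ≼ y → y ≺ z → x ≺ z
≼-≺-trans {x} {y} {z} (le h) (lt k) =
  lt (fraction-≤-<-trans {num x} {num y} {num z} {{3^≢0 (lev y)}} {{3^≢0 (lev x)}} h k)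

≺⇒≼ : ∀ {x y} → x ≺ y → x ≼ y
≺⇒≼ (lt h) = le (<⇒≤ h)

≺-trans : ∀ {x y z} → x ≺ y → y ≺ z → x ≺ z
≺-trans h k = ≺-≼-trans h (≺⇒≼ k)

≼? : ∀ x y → x ≼ y ⊎ y ≺ x
≼? x y with num x * 3 ^ lev y ≤? num y * 3 ^ lev x
... | yes p = inj₁ (le p)
... | no p  = inj₂ (lt (≰⇒> p))

≼⇒⊁ : ∀ {x y} → x ≼ y → ¬ y ≺ x
≼⇒⊁ (le h) (lt k) = ≤⇒≯ h k

≼-refl : ∀ {x} → x ≼ x
≼-refl = le ≤-refl

≼-antisym : ∀ {x y} → x ≼ y → y ≼ x → x ≋ y
≼-antisym (le h) (le k) = eq (≤-antisym h k)

≋-sym : ∀ {x y} → x ≋ y → y ≋ x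
≋-sym (eq h) = eq (sym h)

≋⇒≼ : ∀ {x y} → x ≋ y → x ≼ y
≋⇒≼ (eq h) = le (≤-reflexive h)

≋⇒≽ : ∀ {x y} → x ≋ y → y ≼ x
≋⇒≽ h = ≋⇒≼ (≋-sym h)

infixl 7 _⊙_
_⊙_ : Triadic → Triadic → Triadic
x ⊙ y = num x * num y /3^ lev x + lev y

3^-+ : ∀ a b → 3 ^ (a + b) ≡ 3 ^ a * 3 ^ b
3^-+ = ^-distribˡ-+-* 3

private
  ⊙-cross : ∀ x y x' y' → num (x ⊙ y) * 3 ^ lev (x' ⊙ y') ≡ (num x * 3 ^ lev x') * (num y * 3 ^ lev y')
  ⊙-cross x y x' y' = trans (cong (num x * num y *_) (3^-+ (lev x') (lev y')))
                            (interchange (num x) (num y) (3 ^ lev x') (3 ^ lev y'))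

⊙-mono-≼ : ∀ {x x' y y'} → x ≼ x' → y ≼ y' → x ⊙ y ≼ x' ⊙ y'
⊙-mono-≼ {x} {x'} {y} {y'} (le p) (le q) = le (begin
  num (x ⊙ y) * 3 ^ lev (x' ⊙ y') ≡⟨ ⊙-cross x y x' y' ⟩
  _                               ≤⟨ *-mono-≤ p q ⟩
  _                               ≡⟨ ⊙-cross x' y' x y ⟨
  num (x' ⊙ y') * 3 ^ lev (x ⊙ y) ∎)
  where open ≤-Reasoning

⊙-mono-≺ : ∀ {x x' y y'} → x ≺ x' → y ≺ y' → x ⊙ y ≺ x' ⊙ y'
⊙-mono-≺ {x} {x'} {y} {y'} (lt p) (lt q) = lt (begin-strict
  num (x ⊙ y) * 3 ^ lev (x' ⊙ y') ≡⟨ ⊙-cross x y x' y' ⟩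
  _                               <⟨ *-mono-< p q ⟩
  _                               ≡⟨ ⊙-cross x' y' x y ⟨
  num (x' ⊙ y') * 3 ^ lev (x ⊙ y) ∎)
  where open ≤-Reasoning

⊙-cong : ∀ {x x' y y'} → x ≋ x' → y ≋ y' → x ⊙ y ≋ x' ⊙ y'
⊙-cong {x} {x'} {y} {y'} (eq p) (eq q) =
  eq (trans (⊙-cross x y x' y') (trans (cong₂ _*_ p q) (sym (⊙-cross x' y' x y))))

≋-trans : ∀ {x y z} → x ≋ y → y ≋ z → x ≋ z
≋-trans p q = ≼-antisym
  (≼-trans (≋⇒≼ p) (≋⇒≼ q)) (≼-trans (≋⇒≽ q) (≋⇒≽ p))

-- v + 3^-(lev v + t)
bump : Triadic → ℕ → Triadic
bump v t = num v * 3 ^ t + 1 /3^ lev v + t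

≺-bump : ∀ v t → v ≺ bump v t
≺-bump v t = lt (begin-strict
  num v * 3 ^ (lev v + t)                ≡⟨ cong (num v *_) (3^-+ (lev v) t) ⟩
  num v * (3 ^ lev v * 3 ^ t)            ≡⟨ lem (num v) (3 ^ lev v) (3 ^ t) ⟩
  num v * 3 ^ t * 3 ^ lev v              <⟨ *-monoˡ-< (3 ^ lev v) {{3^≢0 (lev v)}} (m<m+n (num v * 3 ^ t) z<s) ⟩
  (num v * 3 ^ t + 1) * 3 ^ lev v ∎)
  where
  open ≤-Reasoning
  lem : ∀ a b c → a * (b * c) ≡ a * c * b
  lem = solve-∀

-- Both numbers are multiples of 3^-(lev v + lev q), so distinct ones differ by at least that much.
≺⇒bump≼ : ∀ {v q} → v ≺ q → bump v (lev q) ≼ q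
≺⇒bump≼ {v} {q} (lt h) = le (begin
  (num v * 3 ^ lev q + 1) * 3 ^ lev q  ≡⟨ cong (_* 3 ^ lev q) (+-comm (num v * 3 ^ lev q) 1) ⟩
  suc (num v * 3 ^ lev q) * 3 ^ lev q  ≤⟨ *-monoˡ-≤ (3 ^ lev q) h ⟩
  num q * 3 ^ lev v * 3 ^ lev q        ≡⟨ *-assoc (num q) _ _ ⟩
  num q * (3 ^ lev v * 3 ^ lev q)      ≡⟨ cong (num q *_) (3^-+ (lev v) (lev q)) ⟨
  num q * 3 ^ (lev v + lev q) ∎)
  where open ≤-Reasoning

bump-anti : ∀ v {s t} → s < t → bump v t ≺ bump v s
bump-anti v {s} {t} s<t = lt (begin-strict
  (num v * 3 ^ t + 1) * 3 ^ (lev v + s)     ≡⟨ cong ((num v * 3 ^ t + 1) *_) (3^-+ (lev v) s) ⟩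
  (num v * 3 ^ t + 1) * (3 ^ lev v * 3 ^ s) ≡⟨ lem (num v) (3 ^ lev v) (3 ^ s) (3 ^ t) ⟩
  3 ^ lev v * (num v * 3 ^ t * 3 ^ s + 3 ^ s)
    <⟨ *-monoʳ-< (3 ^ lev v) {{3^≢0 (lev v)}} (+-monoʳ-< (num v * 3 ^ t * 3 ^ s) (^-monoʳ-< 3 (s<s z<s) s<t)) ⟩
  3 ^ lev v * (num v * 3 ^ t * 3 ^ s + 3 ^ t) ≡⟨ lem' (num v) (3 ^ lev v) (3 ^ s) (3 ^ t) ⟩
  (num v * 3 ^ s + 1) * (3 ^ lev v * 3 ^ t) ≡⟨ cong ((num v * 3 ^ s + 1) *_) (3^-+ (lev v) t) ⟨
  (num v * 3 ^ s + 1) * 3 ^ (lev v + t) ∎)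
  where
  open ≤-Reasoning
  lem : ∀ n j a b → (n * b + 1) * (j * a) ≡ j * (n * b * a + a)
  lem = solve-∀
  lem' : ∀ n j a b → j * (n * b * a + b) ≡ (n * a + 1) * (j * b)
  lem' = solve-∀

fine : Triadic → Triadic → ℕ → ℕ
fine v w t = (num v + num w) + t

-- With n, m the numerators, the product of the bumps exceeds n m by n + m units of relative size
-- 3^-s and a smaller square term. Together these are at most n + m + 1 ≤ 3^(n + m) units, which is
-- why `fine` adds n + m to t.
bump-⊙ : ∀ v w t → bump v (fine v w t) ⊙ bump w (fine v w t) ≼ bump (v ⊙ w) t
bump-⊙ v w t = le (begin
  (n * 3 ^ s + 1) * (m * 3 ^ s + 1) * 3 ^ ((j + i) + t)
    ≡⟨ cong₂ (λ S E → (n * S + 1) * (m * S + 1) * E) S≡ (trans (3^-+ (j + i) t) (cong (_* 3 ^ t) (3^-+ j i))) ⟩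
  (n * (U * T') + 1) * (m * (U * T') + 1) * (J * I * T')
    ≡⟨ lem n m U T' J I ⟩
  J * I * T' * ((n * m * (U * T') + (n + m)) * (U * T') + 1)
    ≤⟨ *-monoʳ-≤ (J * I * T') bound ⟩
  J * I * T' * ((n * m * (U * T') + U) * (U * T'))
    ≡⟨ lem' n m U T' J I ⟩
  (n * m * T' + 1) * ((J * (U * T')) * (I * (U * T')))
    ≡⟨ cong (λ E → (n * m * T' + 1) * E)
         (trans (3^-+ (j + s) (i + s)) (cong₂ _*_ (trans (3^-+ j s) (cong (J *_) S≡)) (trans (3^-+ i s) (cong (I *_) S≡)))) ⟨
  (n * m * 3 ^ t + 1) * 3 ^ ((j + s) + (i + s)) ∎)
  where
  open ≤-Reasoning
  n = num v
  m = num w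
  j = lev v
  i = lev w
  s = fine v w t
  U = 3 ^ (n + m)
  T' = 3 ^ t
  J = 3 ^ j
  I = 3 ^ i
  S≡ : 3 ^ s ≡ U * T'
  S≡ = 3^-+ (n + m) t
  lem : ∀ n m U T J I → (n * (U * T) + 1) * (m * (U * T) + 1) * (J * I * T)
      ≡ J * I * T * ((n * m * (U * T) + (n + m)) * (U * T) + 1)
  lem = solve-∀
  lem' : ∀ n m U T J I → J * I * T * ((n * m * (U * T) + U) * (U * T))
      ≡ (n * m * T + 1) * ((J * (U * T)) * (I * (U * T)))
  lem' = solve-∀
  bound : (n * m * (U * T') + (n + m)) * (U * T') + 1 ≤ (n * m * (U * T') + U) * (U * T')
  bound = begin
    (n * m * (U * T') + (n + m)) * (U * T') + 1 ≤⟨ +-monoʳ-≤ _ (subst (1 ≤_) S≡ (m^n>0 3 s)) ⟩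
    (n * m * (U * T') + (n + m)) * (U * T') + U * T' ≡⟨ lem'' (n * m * (U * T')) (n + m) (U * T') ⟩
    (n * m * (U * T') + suc (n + m)) * (U * T') ≤⟨ *-monoˡ-≤ (U * T') (+-monoʳ-≤ (n * m * (U * T')) (n<3^n (n + m))) ⟩
    (n * m * (U * T') + U) * (U * T') ∎
    where
    lem'' : ∀ a b c → (a + b) * c + c ≡ (a + (1 + b)) * c
    lem'' = solve-∀

-- Expressions

triples : ℕ → Expr → Expr
triples zero    e = e
triples (suc k) e = (one ⊕ (one ⊕ one)) ⊗ triples k e

eval-triples : ∀ k e → eval (triples k e) ≡ 3 ^ k * eval e
eval-triples zero    e = sym (*-identityˡ (eval e))
eval-triples (suc k) e = trans (cong (3 *_) (eval-triples k e)) (sym (*-assoc 3 (3 ^ k) (eval e)))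

ones-triples : ∀ k e → ones (triples k e) ≡ 3 * k + ones e
ones-triples zero    e = refl
ones-triples (suc k) e = trans (cong (3 +_) (ones-triples k e)) (lem k (ones e))
  where
  lem : ∀ k o → 3 + (3 * k + o) ≡ 3 * (1 + k) + o
  lem = solve-∀

ones≥1 : ∀ e → 1 ≤ ones e
ones≥1 one = ≤-refl
ones≥1 (e ⊕ f) = ≤-trans (ones≥1 e) (m≤m+n _ _)
ones≥1 (e ⊗ f) = ≤-trans (ones≥1 e) (m≤m+n _ _)

eval≥1 : ∀ e → 1 ≤ eval e
eval≥1 one = ≤-refl
eval≥1 (e ⊕ f) = ≤-trans (eval≥1 e) (m≤m+n _ _)
eval≥1 (e ⊗ f) = *-mono-≤ (eval≥1 e) (eval≥1 f)

-- T β is { x : c(x) ≤ 2 - β }, where c is the stable complexity extended to triadic numbers; here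
-- 2 - β may be negative.
record T (β : ℕ) (x : Triadic) : Set where
  constructor rep
  field
    level : ℕ
    expr  : Expr
    value : num x * 3 ^ level ≡ 3 ^ lev x * eval expr
    cost  : ones expr + β ≤ 3 * level + 2

T-resp : ∀ {β x y} → x ≋ y → T β x → T β y
T-resp {_} {x} {y} (eq x≋y) (rep i e v c) = rep i e (*-cancelˡ-≡ _ _ (3 ^ lev x) {{3^≢0 (lev x)}} (begin-equality
  3 ^ lev x * (num y * 3 ^ i) ≡⟨ lem (3 ^ lev x) (num y) (3 ^ i) ⟩
  num y * 3 ^ lev x * 3 ^ i   ≡⟨ cong (_* 3 ^ i) x≋y ⟨
  num x * 3 ^ lev y * 3 ^ i   ≡⟨ xy∙z≈xz∙y (num x) _ _ ⟩
  num x * 3 ^ i * 3 ^ lev y   ≡⟨ cong (_* 3 ^ lev y) v ⟩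
  3 ^ lev x * eval e * 3 ^ lev y ≡⟨ lem' (3 ^ lev x) (eval e) (3 ^ lev y) ⟩
  3 ^ lev x * (3 ^ lev y * eval e) ∎)) c
  where
  open ≤-Reasoning
  lem : ∀ a b c → a * (b * c) ≡ b * a * c
  lem = solve-∀
  lem' : ∀ a b c → a * b * c ≡ a * (c * b)
  lem' = solve-∀

T-anti : ∀ {β γ x} → γ ≤ β → T β x → T γ x
T-anti γ≤β (rep i e v c) = rep i e v (≤-trans (+-monoʳ-≤ (ones e) γ≤β) c)

-- Complexities add under products: (2 - β₁) + (2 - β₂) = 2 - β.
T-⊙ : ∀ {β β₁ β₂ x y} → β₁ + β₂ ≡ β + 2 → T β₁ x → T β₂ y → T β (x ⊙ y)
T-⊙ {β} {β₁} {β₂} {x} {y} sum≡ (rep i e v c) (rep j f w d) = rep (i + j) (e ⊗ f)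
  (begin-equality
    num x * num y * 3 ^ (i + j) ≡⟨ ⊙-cross x y (0 /3^ i) (0 /3^ j) ⟩
    num x * 3 ^ i * (num y * 3 ^ j) ≡⟨ cong₂ _*_ v w ⟩
    3 ^ lev x * eval e * (3 ^ lev y * eval f) ≡⟨ interchange (3 ^ lev x) (eval e) (3 ^ lev y) (eval f) ⟩
    3 ^ lev x * 3 ^ lev y * (eval e * eval f) ≡⟨ cong (_* (eval e * eval f)) (3^-+ (lev x) (lev y)) ⟨
    3 ^ (lev x + lev y) * (eval e * eval f) ∎)
  (+-cancelʳ-≤ 2 _ _ (begin
    ones e + ones f + β + 2 ≡⟨ +-assoc (ones e + ones f) β 2 ⟩
    ones e + ones f + (β + 2) ≡⟨ cong (ones e + ones f +_) sum≡ ⟨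
    ones e + ones f + (β₁ + β₂) ≡⟨ lem (ones e) (ones f) β₁ β₂ ⟩
    (ones e + β₁) + (ones f + β₂) ≤⟨ +-mono-≤ c d ⟩
    (3 * i + 2) + (3 * j + 2) ≡⟨ lem' i j ⟩
    3 * (i + j) + 2 + 2 ∎))
  where
  open ≤-Reasoning
  lem : ∀ a b c d → a + b + (c + d) ≡ (a + c) + (b + d)
  lem = solve-∀
  lem' : ∀ i j → (3 * i + 2) + (3 * j + 2) ≡ 3 * (i + j) + 2 + 2
  lem' = solve-∀

-- Scale the witness of `v` by powers of 3, which leaves the complexity unchanged, then add a single
-- `one`. The new level must be at least that of the witness, hence the offset `i`.
T-bump : ∀ {β v} → T (suc β) v → ∃ λ i → ∀ s → T β (bump v (i + s))
T-bump {β} {v} (rep i e val c) = i , λ s → rep (lev v + (i + s)) (triples (lev v + s) e ⊕ one)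
  (begin-equality
    (num v * 3 ^ (i + s) + 1) * L s ≡⟨ *-comm (num v * 3 ^ (i + s) + 1) (L s) ⟩
    L s * (num v * 3 ^ (i + s) + 1) ≡⟨ cong (λ z → L s * (z + 1)) (begin-equality
       num v * 3 ^ (i + s) ≡⟨ cong (num v *_) (3^-+ i s) ⟩
       num v * (3 ^ i * 3 ^ s) ≡⟨ *-assoc (num v) (3 ^ i) (3 ^ s) ⟨
       num v * 3 ^ i * 3 ^ s ≡⟨ cong (_* 3 ^ s) val ⟩
       3 ^ lev v * eval e * 3 ^ s ≡⟨ xy∙z≈xz∙y (3 ^ lev v) (eval e) (3 ^ s) ⟩
       3 ^ lev v * 3 ^ s * eval e ≡⟨ cong (_* eval e) (3^-+ (lev v) s) ⟨
       3 ^ (lev v + s) * eval e ≡⟨ eval-triples (lev v + s) e ⟨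
       eval (triples (lev v + s) e) ∎) ⟩
    L s * (eval (triples (lev v + s) e) + 1) ∎)
  (begin
    ones (triples (lev v + s) e) + 1 + β ≡⟨ cong (λ z → z + 1 + β) (ones-triples (lev v + s) e) ⟩
    3 * (lev v + s) + ones e + 1 + β     ≡⟨ lem (3 * (lev v + s)) (ones e) β ⟩
    3 * (lev v + s) + (ones e + suc β)   ≤⟨ +-monoʳ-≤ (3 * (lev v + s)) c ⟩
    3 * (lev v + s) + (3 * i + 2)        ≡⟨ lem' (lev v) s i ⟩
    3 * (lev v + (i + s)) + 2 ∎)
  where
  open ≤-Reasoning
  L : ℕ → ℕ
  L s = 3 ^ (lev v + (i + s))
  lem : ∀ a o b → a + o + 1 + b ≡ a + (o + (1 + b))
  lem = solve-∀
  lem' : ∀ l s i → 3 * (l + s) + (3 * i + 2) ≡ 3 * (l + (i + s)) + 2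
  lem' = solve-∀

-- Scattered sets

-- A constructive substitute for "X is covered by a countable compact subset of T β whose limit
-- points, all approached from above only, lie in T (1 + β)".
data Scattered (β : ℕ) (X : Triadic → Set) : Set₁ where
  none  : (∀ {x} → ¬ X x) → Scattered β X
  point : ∀ v → T β v → (∀ {x} → X x → x ≋ v) → Scattered β X
  union : ∀ Y Z → Scattered β Y → Scattered β Z → (∀ {x} → X x → Y x ⊎ Z x) → Scattered β X
  limit : ∀ v → T (suc β) v → (∀ {x} → X x → v ≼ x) →
          (∀ t → Scattered β (λ x → X x × bump v t ≼ x)) → Scattered β X

module _ {β : ℕ} where

  -- The constructor `union` asks only for a cover, so a union with the empty set passes to a
  -- subset.
  scattered-⊆ : ∀ {X Y} → (∀ {x} → X x → Y x) → Scattered β Y → Scattered β X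
  scattered-⊆ {Y = Y} X⊆Y c = union Y (λ _ → ⊥) c (none λ ()) (λ p → inj₁ (X⊆Y p))

  scattered-weaken : ∀ {X} → Scattered (suc β) X → Scattered β X
  scattered-weaken (none n) = none n
  scattered-weaken (point v p s) = point v (T-anti (n≤1+n β) p) s
  scattered-weaken (union Y Z a b s) = union Y Z (scattered-weaken a) (scattered-weaken b) s
  scattered-weaken (limit v p l c) = limit v (T-anti (n≤1+n _) p) l (λ t → scattered-weaken (c t))

scattered-⋃ : ∀ {β} K (X : ℕ → Triadic → Set) → (∀ i → i < K → Scattered β (X i)) →
              Scattered β (λ z → ∃ λ i → i < K × X i z)
scattered-⋃ zero X c = none λ { (_ , () , _) }
scattered-⋃ {β} (suc K) X c = union (λ z → ∃ λ i → i < K × X i z) (X K)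
  (scattered-⋃ K X (λ i i<K → c i (m<n⇒m<1+n i<K))) (c K ≤-refl) split
  where
  split : ∀ {z} → (∃ λ i → i < suc K × X i z) → (∃ λ i → i < K × X i z) ⊎ X K z
  split (i , i<1+K , x) with m≤n⇒m<n∨m≡n i<1+K
  ... | inj₁ h    = inj₁ (i , ≤-pred h , x)
  ... | inj₂ refl = inj₂ x

-- Products

infixl 7 _·_
_·_ : (X Y : Triadic → Set) → Triadic → Set
(X · Y) z = ∃ λ x → ∃ λ y → X x × Y y × z ≋ x ⊙ y

⊙-lower : ∀ {v w x y z} → v ≼ x → w ≼ y → z ≋ x ⊙ y → v ⊙ w ≼ z
⊙-lower v≼x w≼y e =
  ≼-trans (⊙-mono-≼ v≼x w≼y) (≋⇒≽ e)

-- A product bounded away from v w has a factor bounded away from v or from w; this is what lets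
-- products be taken limit by limit.
⊙-split : ∀ v w x y {z} t → z ≋ x ⊙ y → bump (v ⊙ w) t ≼ z →
          bump v (fine v w t) ≼ x ⊎ bump w (fine v w t) ≼ y
⊙-split v w x y t e h with ≼? (bump v (fine v w t)) x | ≼? (bump w (fine v w t)) y
... | inj₁ p | _      = inj₁ p
... | inj₂ _ | inj₁ q = inj₂ q
... | inj₂ p | inj₂ q = ⊥-elim (≼⇒⊁
        (≼-trans h (≋⇒≼ e))
        (≺-≼-trans
          (⊙-mono-≺ p q) (bump-⊙ v w t)))

≋⇒¬bump : ∀ {v x t} → x ≋ v → ¬ bump v t ≼ x
≋⇒¬bump e b = ≼⇒⊁ (≋⇒≼ e) (≺-≼-trans (≺-bump _ _) b)

module _ {X Y : Triadic → Set} (v w : Triadic) (t : ℕ) where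
  private s = fine v w t

  ·-split : ∀ {z} → (X · Y) z × bump (v ⊙ w) t ≼ z →
            ((λ x → X x × bump v s ≼ x) · Y) z ⊎ (X · (λ y → Y y × bump w s ≼ y)) z
  ·-split {z} ((x , y , xX , yY , e) , h) with ⊙-split v w x y t e h
  ... | inj₁ b = inj₁ (x , y , (xX , b) , yY , e)
  ... | inj₂ b = inj₂ (x , y , xX , (yY , b) , e)

  ·-splitˡ : (∀ {y} → Y y → y ≋ w) → ∀ {z} → (X · Y) z × bump (v ⊙ w) t ≼ z →
             ((λ x → X x × bump v s ≼ x) · Y) z
  ·-splitˡ Y≋w p with ·-split p
  ... | inj₁ q = q
  ... | inj₂ (_ , y , _ , (yY , b) , _) = ⊥-elim (≋⇒¬bump (Y≋w yY) b)

  ·-splitʳ : (∀ {x} → X x → x ≋ v) → ∀ {z} → (X · Y) z × bump (v ⊙ w) t ≼ z →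
             (X · (λ y → Y y × bump w s ≼ y)) z
  ·-splitʳ X≋v p with ·-split p
  ... | inj₁ (x , _ , (xX , b) , _ , _) = ⊥-elim (≋⇒¬bump (X≋v xX) b)
  ... | inj₂ q = q

·-unionˡ : ∀ {X Y Z W : Triadic → Set} → (∀ {x} → X x → Y x ⊎ Z x) → ∀ {z} → (X · W) z → (Y · W) z ⊎ (Z · W) z
·-unionˡ s (x , y , p , q) with s p
... | inj₁ p' = inj₁ (x , y , p' , q)
... | inj₂ p' = inj₂ (x , y , p' , q)

·-unionʳ : ∀ {X Y Z W : Triadic → Set} → (∀ {x} → X x → Y x ⊎ Z x) → ∀ {z} → (W · X) z → (W · Y) z ⊎ (W · Z) z
·-unionʳ s (x , y , p , q , e) with s q
... | inj₁ q' = inj₁ (x , y , p , q' , e)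
... | inj₂ q' = inj₂ (x , y , p , q' , e)

-- The limit points of the product are limit times point and limit times limit. Away from such a
-- limit one factor is bounded away from its own limit, so each recursive call shrinks one of the
-- two trees and keeps the other.
scattered-product : ∀ {β₁ β₂ β} {X Y} → β₁ + β₂ ≡ β + 2 → Scattered β₁ X → Scattered β₂ Y → Scattered β (X · Y)
scattered-product sum≡ c (none n) = none λ { (_ , _ , _ , q , _) → n q }
scattered-product {X = X} sum≡ c (union Y Z a b u) =
  union (X · Y) (X · Z) (scattered-product sum≡ c a) (scattered-product sum≡ c b) (·-unionʳ u)
scattered-product sum≡ (none n) c = none λ { (_ , _ , p , _) → n p }
scattered-product {Y = W} sum≡ (union Y Z a b s) c =
  union (Y · W) (Z · W) (scattered-product sum≡ a c) (scattered-product sum≡ b c) (·-unionˡ s)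
scattered-product sum≡ (point v p s) (point w q u) =
  point (v ⊙ w) (T-⊙ sum≡ p q) λ { (x , y , xX , yY , e) →
    ≋-trans e (⊙-cong (s xX) (u yY)) }
scattered-product sum≡ (limit v p l f) c@(point w q u) =
  limit (v ⊙ w) (T-⊙ (cong suc sum≡) p q)
    (λ { (x , y , xX , yY , e) → ⊙-lower (l xX) (≋⇒≽ (u yY)) e })
    λ t → scattered-⊆ (·-splitˡ v w t u) (scattered-product sum≡ (f (fine v w t)) c)
scattered-product {β₁} {β₂} sum≡ c@(point v p s) (limit w q l f) =
  limit (v ⊙ w) (T-⊙ (trans (+-suc β₁ β₂) (cong suc sum≡)) p q)
    (λ { (x , y , xX , yY , e) → ⊙-lower (≋⇒≽ (s xX)) (l yY) e })
    λ t → scattered-⊆ (·-splitʳ v w t s) (scattered-product sum≡ c (f (fine v w t)))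
scattered-product {X = X} {Y} sum≡ c@(limit v p l f) d@(limit w q m g) =
  -- Two limit points have complexity to spare: their product even lies two steps deeper than `T β`,
  -- and one step is given away.
  limit (v ⊙ w) (T-⊙ (cong suc sum≡) p (T-anti (n≤1+n _) q))
    (λ { (x , y , xX , yY , e) → ⊙-lower (l xX) (m yY) e })
    λ t → union ((λ x → X x × bump v (fine v w t) ≼ x) · Y) (X · (λ y → Y y × bump w (fine v w t) ≼ y))
            (scattered-product sum≡ (f (fine v w t)) d) (scattered-product sum≡ c (g (fine v w t))) (·-split v w t)

-- Expressions at bounded level

-- These are the expressions of height at most k, a finite list that contains every expression with
-- at most k ones. The exact cost is tested again where the list is used.
exprs : ℕ → List Expr
exprs zero    = []
exprs (suc k) = one ∷ cartesianProductWith _⊕_ (exprs k) (exprs k)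
                   ++ cartesianProductWith _⊗_ (exprs k) (exprs k)

private
  split-ones : ∀ e f {k} → ones e + ones f ≤ suc k → ones e ≤ k × ones f ≤ k
  split-ones e f h =
    ≤-pred (≤-trans (subst (_≤ ones e + ones f) (+-comm (ones e) 1) (+-monoʳ-≤ (ones e) (ones≥1 f))) h) ,
    ≤-pred (≤-trans (+-monoˡ-≤ (ones f) (ones≥1 e)) h)

∈-exprs : ∀ k e → ones e ≤ k → e ∈ exprs k
∈-exprs zero e h = ⊥-elim (<⇒≱ (ones≥1 e) h)
∈-exprs (suc k) one h = here refl
∈-exprs (suc k) (e ⊕ f) h with split-ones e f h
... | p , q = there (∈-++⁺ˡ (∈-cartesianProductWith⁺ _⊕_ (∈-exprs k e p) (∈-exprs k f q)))
∈-exprs (suc k) (e ⊗ f) h with split-ones e f h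
... | p , q = there (∈-++⁺ʳ (cartesianProductWith _⊕_ (exprs k) (exprs k))
                (∈-cartesianProductWith⁺ _⊗_ (∈-exprs k e p) (∈-exprs k f q)))

Level : ℕ → ℕ → Triadic → Set
Level β j z = ∃ λ e → z ≋ (eval e /3^ j) × ones e + β ≤ 3 * j + 2

LevelBelow : ℕ → ℕ → Triadic → Set
LevelBelow β J z = ∃ λ j → j < J × Level β j z

scattered-Level : ∀ β j → Scattered β (Level β j)
scattered-Level β j = scattered-⊆
  (λ { (e , p , c) → e , ∈-exprs (3 * j + 2) e (≤-trans (m≤m+n _ _) c) , p , c })
  (listed (exprs (3 * j + 2)))
  where
  Listed : List Expr → Triadic → Set
  Listed es z = ∃ λ e → e ∈ es × z ≋ (eval e /3^ j) × ones e + β ≤ 3 * j + 2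
  listed : ∀ es → Scattered β (Listed es)
  listed [] = none λ { (_ , () , _) }
  listed (e ∷ es) with ones e + β ≤? 3 * j + 2
  ... | yes c = union (_≋ (eval e /3^ j)) (Listed es)
                  (point (eval e /3^ j) (rep j e (*-comm (eval e) (3 ^ j)) c) (λ p → p)) (listed es)
                  λ { (_ , here refl , p , _) → inj₁ p ; (f , there i , p) → inj₂ (f , i , p) }
  ... | no ¬c = scattered-⊆
    (λ { (_ , here refl , _ , c) → ⊥-elim (¬c c) ; (f , there i , p) → f , i , p }) (listed es)

scattered-LevelBelow : ∀ β J → Scattered β (LevelBelow β J)
scattered-LevelBelow β J = scattered-⋃ J (Level β) (λ j _ → scattered-Level β j)

-- Sums with a bounded second summand

-- Here z = base + m / 3^j, with j unbounded and m ≤ M. The expression `e` and its cost are recorded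
-- so that the finitely many sums away from the limit points are known to lie in `T β`.
record Translate (β M : ℕ) (X : Triadic → Set) (z : Triadic) : Set where
  constructor translate
  field
    {base}  : Triadic
    base∈X  : X base
    j k m   : ℕ
    e       : Expr
    base≋   : base ≋ (k /3^ j)
    eval≡   : eval e ≡ k + m
    m≤M     : m ≤ M
    cost    : ones e + β ≤ 3 * j + 2
    z≋      : z ≋ (eval e /3^ j)

base≼ : ∀ {β M X z} (τ : Translate β M X z) → Translate.base τ ≼ z
base≼ (translate _ j k m e x≋ ev _ _ z≋) = ≼-trans (≋⇒≼ x≋)
  (≼-trans (le (*-monoˡ-≤ (3 ^ j) (subst (k ≤_) (sym ev) (m≤m+n k m)))) (≋⇒≽ z≋))

-- The second summand m / 3^j is here at least the difference of the two bumps, which bounds j.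
translate-level : ∀ {β M X z} v t (τ : Translate β M X z) →
  Translate.base τ ≺ bump v (suc t) → bump v t ≼ z → LevelBelow β (M * (3 * 3 ^ (lev v + t))) z
translate-level {β} {M} {X} {z} v t (translate {x} _ j k m e x≋ ev m≤M c z≋) x≺ ≼z =
  j , <-≤-trans (n<3^n j) (≤-trans (+-cancelˡ-≤ (3 * A * P + P) _ _ chain) (*-monoˡ-≤ (3 * E) m≤M)) , e , z≋ , c
  where
  open ≤-Reasoning
  A = num v * 3 ^ t
  P = 3 ^ j
  E = 3 ^ (lev v + t)
  h₁ : k * (3 * E) < (num v * (3 * 3 ^ t) + 1) * P
  h₁ = subst (λ a → k * 3 ^ a < (num v * (3 * 3 ^ t) + 1) * P) (+-suc (lev v) t)
         (_≺_.cross (≼-≺-trans (≋⇒≽ x≋) x≺))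
  h₂ : (A + 1) * P ≤ (k + m) * E
  h₂ = subst (λ a → (A + 1) * P ≤ a * E) ev (_≼_.cross (≼-trans ≼z (≋⇒≼ z≋)))
  lem₁ : ∀ A P → (3 * A * P + P) + P + P ≡ 3 * ((A + 1) * P)
  lem₁ = solve-∀
  lem₂ : ∀ k m E → 3 * ((k + m) * E) ≡ k * (3 * E) + m * (3 * E)
  lem₂ = solve-∀
  lem₃ : ∀ n s P → (n * (3 * s) + 1) * P ≡ 3 * (n * s) * P + P
  lem₃ = solve-∀
  -- Over the denominator 3E the base is below 3A + 1 and `z` is at least 3A + 3, so m / 3^j exceeds
  -- 2 / (3E). One of these two units is enough.
  chain : (3 * A * P + P) + P ≤ (3 * A * P + P) + m * (3 * E)
  chain = begin
    (3 * A * P + P) + P      ≤⟨ m≤m+n _ P ⟩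
    (3 * A * P + P) + P + P  ≡⟨ lem₁ A P ⟩
    3 * ((A + 1) * P)        ≤⟨ *-monoʳ-≤ 3 h₂ ⟩
    3 * ((k + m) * E)        ≡⟨ lem₂ k m E ⟩
    k * (3 * E) + m * (3 * E) ≤⟨ +-monoˡ-≤ (m * (3 * E)) (<⇒≤ h₁) ⟩
    (num v * (3 * 3 ^ t) + 1) * P + m * (3 * E) ≡⟨ cong (_+ m * (3 * E)) (lem₃ (num v) (3 ^ t) P) ⟩
    (3 * A * P + P) + m * (3 * E) ∎

-- A point of X becomes a limit point, since its sums with m / 3^j descend to it as j grows. A limit
-- point stays one: away from it, either the base is already bounded away or the level is bounded.
-- The index drops by one because a point turned limit must lie in `T (suc β)`.
scattered-translate : ∀ {β X} M → Scattered (suc β) X → Scattered β (Translate β M X)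
scattered-translate M (none n) = none λ τ → n (Translate.base∈X τ)
scattered-translate {β} M (union Y Z a b s) =
  union (Translate β M Y) (Translate β M Z) (scattered-translate M a) (scattered-translate M b) split
  where
  split : ∀ {z} → Translate β M _ z → Translate β M Y z ⊎ Translate β M Z z
  split (translate p j k m e x≋ ev m≤M c z≋) with s p
  ... | inj₁ q = inj₁ (translate q j k m e x≋ ev m≤M c z≋)
  ... | inj₂ q = inj₂ (translate q j k m e x≋ ev m≤M c z≋)
scattered-translate {β} M (point v p s) = limit v p
  (λ τ → ≼-trans (≋⇒≽ (s (Translate.base∈X τ))) (base≼ τ))
  λ t → scattered-⊆ (λ { (τ , h) → translate-level v t τ
      (≼-≺-trans (≋⇒≼ (s (Translate.base∈X τ))) (≺-bump v (suc t))) h })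
    (scattered-LevelBelow β _)
scattered-translate {β} {X} M (limit v p l f) = limit v (T-anti (n≤1+n _) p)
  (λ τ → ≼-trans (l (Translate.base∈X τ)) (base≼ τ))
  λ t → union (Translate β M (λ x → X x × bump v (suc t) ≼ x)) (LevelBelow β (M * (3 * 3 ^ (lev v + t))))
          (scattered-translate M (f (suc t))) (scattered-LevelBelow β (M * (3 * 3 ^ (lev v + t)))) (split t)
  where
  split : ∀ t {z} → Translate β M X z × bump v t ≼ z →
          Translate β M (λ x → X x × bump v (suc t) ≼ x) z ⊎ LevelBelow β (M * (3 * 3 ^ (lev v + t))) z
  split t (τ@(translate {x} q j k m e x≋ ev m≤M c z≋) , h) with ≼? (bump v (suc t)) x
  ... | inj₁ b = inj₁ (translate (q , b) j k m e x≋ ev m≤M c z≋)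
  ... | inj₂ b = inj₂ (translate-level v t τ b h)

-- Defects

-- The defect o - 3 log₃ v is log₃ (3^o / v³), so with cubes all defect estimates become
-- inequalities of integers.
cube : ℕ → ℕ
cube n = n * n * n

cube-mono : ∀ {m n} → m ≤ n → cube m ≤ cube n
cube-mono h = *-mono-≤ (*-mono-≤ h h) h

cube-* : ∀ m n → cube (m * n) ≡ cube m * cube n
cube-* = lem
  where
  lem : ∀ m n → (m * n) * (m * n) * (m * n) ≡ m * m * m * (n * n * n)
  lem = solve-∀

cube-3^ : ∀ i → cube (3 ^ i) ≡ 3 ^ (3 * i)
cube-3^ i = begin-equality
  3 ^ i * 3 ^ i * 3 ^ i    ≡⟨ cong (_* 3 ^ i) (3^-+ i i) ⟨
  3 ^ (i + i) * 3 ^ i      ≡⟨ 3^-+ (i + i) i ⟨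
  3 ^ (i + i + i)          ≡⟨ cong (3 ^_) (lem i) ⟩
  3 ^ (3 * i)              ∎
  where
  open ≤-Reasoning
  lem : ∀ i → i + i + i ≡ 3 * i
  lem = solve-∀

cube-3^≢0 : ∀ i → NonZero (cube (3 ^ i))
cube-3^≢0 i = subst NonZero (sym (cube-3^ i)) (3^≢0 (3 * i))

n≤cube : ∀ n → n ≤ cube n
n≤cube zero = z≤n
n≤cube n@(suc _) = ≤-trans (m≤m*n n n) (m≤m*n (n * n) n)

-- This is defect zero.
Trivial : ℕ → ℕ → Set
Trivial v o = ∃ λ i → v ≡ 3 ^ i × o ≡ 3 * i

-- The defect o - 3 log₃ v is at least that of 2 = 1 + 1.
Defective : ℕ → ℕ → Set
Defective v o = 9 * cube v ≤ 8 * 3 ^ o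

cube-bound : ∀ {v o} → Trivial v o ⊎ Defective v o → cube v ≤ 3 ^ o
cube-bound (inj₁ (i , refl , refl)) = ≤-reflexive (cube-3^ i)
cube-bound {v} (inj₂ d) = *-cancelˡ-≤ 8 (≤-trans (*-monoˡ-≤ (cube v) (n≤1+n 8)) d)

cube-sum : ∀ {m n} → m ≤ n → cube (n + m) ≤ 8 * cube n
cube-sum {m} {n} m≤n = begin
  cube (n + m) ≤⟨ cube-mono (+-monoʳ-≤ n m≤n) ⟩
  cube (n + n) ≡⟨ lem n ⟩
  8 * cube n   ∎
  where
  open ≤-Reasoning
  lem : ∀ n → (n + n) * (n + n) * (n + n) ≡ 8 * (n * n * n)
  lem = solve-∀

cube-suc : ∀ {n} → 3 ≤ n → 27 * cube (n + 1) ≤ 64 * cube n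
cube-suc {n} 3≤n = begin
  27 * cube (n + 1) ≡⟨ lem n ⟩
  cube (3 * n + 3)  ≤⟨ cube-mono (+-monoʳ-≤ (3 * n) 3≤n) ⟩
  cube (3 * n + n)  ≡⟨ lem' n ⟩
  64 * cube n       ∎
  where
  open ≤-Reasoning
  lem : ∀ n → 27 * ((n + 1) * (n + 1) * (n + 1)) ≡ (3 * n + 3) * (3 * n + 3) * (3 * n + 3)
  lem = solve-∀
  lem' : ∀ n → (3 * n + n) * (3 * n + n) * (3 * n + n) ≡ 64 * (n * n * n)
  lem' = solve-∀

2≤-exponent : ∀ {v o} → 2 ≤ v → cube v ≤ 3 ^ o → 2 ≤ o
2≤-exponent {o = zero}        h c = ⊥-elim (<⇒≱ (s≤s (s≤s z≤n)) (≤-trans (cube-mono h) c))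
2≤-exponent {o = suc zero}    h c = ⊥-elim (<⇒≱ (s≤s (s≤s (s≤s (s≤s z≤n)))) (≤-trans (cube-mono h) c))
2≤-exponent {o = suc (suc _)} h c = s≤s (s≤s z≤n)

-- If m ≥ 2, the cube grows at most by a factor 8 and 3^ones at least by 9. If m = 1 and n ≥ 3, the
-- factors are 64/27 and 3. The remaining sums are 1 + 1, which is extremal, and 2 + 1, which has
-- defect zero exactly when it uses three ones.
classify-sum : ∀ n m {k l} → 1 ≤ m → m ≤ n → 1 ≤ k → 1 ≤ l → cube n ≤ 3 ^ k → cube m ≤ 3 ^ l →
               Trivial (n + m) (k + l) ⊎ Defective (n + m) (k + l)
classify-sum 0 (suc _) _ () _ _ _ _
classify-sum 1 1 {k} {l} _ _ 1≤k 1≤l _ _ = inj₂ (*-monoʳ-≤ 8 (^-monoʳ-≤ 3 (+-mono-≤ 1≤k 1≤l)))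
classify-sum 2 1 {k} {l} _ _ _ 1≤l cn _ with m≤n⇒m<n∨m≡n (+-mono-≤ (2≤-exponent (≤-refl {2}) cn) 1≤l)
... | inj₂ 3≡ = inj₁ (1 , refl , sym 3≡)
... | inj₁ 4≤ = inj₂ (≤-trans (m≤n+m 243 405) (*-monoʳ-≤ 8 (^-monoʳ-≤ 3 4≤)))
classify-sum n@(suc (suc (suc n'))) 1 {k} {l} _ _ _ 1≤l cn _ = inj₂ (*-cancelˡ-≤ 3 (begin
  3 * (9 * cube (n + 1)) ≡⟨ *-assoc 3 9 (cube (n + 1)) ⟨
  27 * cube (n + 1)      ≤⟨ cube-suc {n} (s≤s (s≤s (s≤s z≤n))) ⟩
  64 * cube n            ≤⟨ *-mono-≤ (m≤m+n 64 8) cn ⟩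
  72 * 3 ^ k             ≡⟨ lem (3 ^ k) ⟩
  3 * (8 * (3 ^ k * 3))  ≡⟨ cong (λ z → 3 * (8 * z)) (3^-+ k 1) ⟨
  3 * (8 * 3 ^ (k + 1))  ≤⟨ *-monoʳ-≤ 3 (*-monoʳ-≤ 8 (^-monoʳ-≤ 3 (+-monoʳ-≤ k 1≤l))) ⟩
  3 * (8 * 3 ^ (k + l))  ∎))
  where
  open ≤-Reasoning
  lem : ∀ a → 72 * a ≡ 3 * (8 * (a * 3))
  lem = solve-∀
classify-sum n m@(suc (suc _)) {k} {l} _ m≤n _ _ cn cm = inj₂ (begin
  9 * cube (n + m)  ≤⟨ *-monoʳ-≤ 9 (cube-sum m≤n) ⟩
  9 * (8 * cube n)  ≤⟨ *-monoʳ-≤ 9 (*-monoʳ-≤ 8 cn) ⟩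
  9 * (8 * 3 ^ k)   ≡⟨ lem (3 ^ k) ⟩
  8 * (3 ^ k * 9)   ≡⟨ cong (8 *_) (3^-+ k 2) ⟨
  8 * 3 ^ (k + 2)   ≤⟨ *-monoʳ-≤ 8 (^-monoʳ-≤ 3 (+-monoʳ-≤ k (2≤-exponent (s≤s (s≤s z≤n)) cm))) ⟩
  8 * 3 ^ (k + l)   ∎)
  where
  open ≤-Reasoning
  lem : ∀ a → 9 * (8 * a) ≡ 8 * (a * 9)
  lem = solve-∀

classify : ∀ e → Trivial (eval e) (ones e) ⊎ Defective (eval e) (ones e)
classify one = inj₂ (m≤n+m 9 15)
classify (e ⊕ f) with ≤-total (eval f) (eval e)
... | inj₁ h = classify-sum (eval e) (eval f) (eval≥1 f) h (ones≥1 e) (ones≥1 f)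
                 (cube-bound (classify e)) (cube-bound (classify f))
... | inj₂ h = subst₂ (λ v o → Trivial v o ⊎ Defective v o) (+-comm (eval f) _) (+-comm (ones f) _)
                 (classify-sum (eval f) (eval e) (eval≥1 e) h (ones≥1 f) (ones≥1 e)
                   (cube-bound (classify f)) (cube-bound (classify e)))
classify (e ⊗ f) with classify e | classify f
... | inj₁ (i , p , q) | inj₁ (j , r , s) =
  inj₁ (i + j , trans (cong₂ _*_ p r) (sym (3^-+ i j)) , trans (cong₂ _+_ q s) (sym (*-distribˡ-+ 3 i j)))
... | inj₂ d | c = inj₂ (begin
  9 * cube (eval e * eval f)        ≡⟨ cong (9 *_) (cube-* (eval e) (eval f)) ⟩
  9 * (cube (eval e) * cube (eval f)) ≡⟨ *-assoc 9 (cube (eval e)) _ ⟨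
  9 * cube (eval e) * cube (eval f) ≤⟨ *-mono-≤ d (cube-bound c) ⟩
  8 * 3 ^ ones e * 3 ^ ones f       ≡⟨ *-assoc 8 (3 ^ ones e) _ ⟩
  8 * (3 ^ ones e * 3 ^ ones f)     ≡⟨ cong (8 *_) (3^-+ (ones e) (ones f)) ⟨
  8 * 3 ^ (ones e + ones f)         ∎)
  where open ≤-Reasoning
... | c@(inj₁ _) | inj₂ d = inj₂ (begin
  9 * cube (eval e * eval f)        ≡⟨ cong (9 *_) (cube-* (eval e) (eval f)) ⟩
  9 * (cube (eval e) * cube (eval f)) ≡⟨ x∙yz≈y∙xz 9 (cube (eval e)) _ ⟩
  cube (eval e) * (9 * cube (eval f)) ≤⟨ *-mono-≤ (cube-bound c) d ⟩
  3 ^ ones e * (8 * 3 ^ ones f)     ≡⟨ x∙yz≈y∙xz (3 ^ ones e) 8 _ ⟩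
  8 * (3 ^ ones e * 3 ^ ones f)     ≡⟨ cong (8 *_) (3^-+ (ones e) (ones f)) ⟨
  8 * 3 ^ (ones e + ones f)         ∎)
  where open ≤-Reasoning

-- The classical lower bound 3 log₃ n for the complexity of n.
eval-bound : ∀ e → cube (eval e) ≤ 3 ^ ones e
eval-bound e = cube-bound (classify e)

-- Expressions without factors of defect zero

-- Each form other than `small` has parts of defect lower by a full unit. Only values and costs are
-- recorded, so that summands can be put in decreasing order. The bound 3 ≤ eval f in `incr` is what
-- keeps the growth factor at 4/3.
data Shape (e : Expr) : Set where
  small : eval e ≤ 3 → Shape e
  incr  : ∀ f g → eval g ≡ 1 → 3 ≤ eval f →
          eval e ≡ eval f + eval g → ones e ≡ ones f + ones g → Shape e
  sum   : ∀ f g → 2 ≤ eval g → eval g ≤ eval f →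
          eval e ≡ eval f + eval g → ones e ≡ ones f + ones g → Shape e
  prod  : ∀ f g → Defective (eval f) (ones f) → Defective (eval g) (ones g) →
          eval e ≡ eval f * eval g → ones e ≡ ones f + ones g → Shape e

shape-⊕ : ∀ e f g → eval g ≤ eval f → eval e ≡ eval f + eval g → ones e ≡ ones f + ones g → Shape e
shape-⊕ e f g h v o with eval g in eqg
... | zero = ⊥-elim (<⇒≱ (eval≥1 g) (≤-reflexive eqg))
... | suc (suc _) = sum f g (subst (2 ≤_) (sym eqg) (s≤s (s≤s z≤n))) (subst (_≤ eval f) (sym eqg) h)
                      (trans v (cong (eval f +_) (sym eqg))) o
... | suc zero with 3 ≤? eval f
...   | yes 3≤ = incr f g eqg 3≤ (trans v (cong (eval f +_) (sym eqg))) o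
...   | no ¬3≤ = small (subst (_≤ 3) (sym v) (+-monoˡ-≤ 1 (≤-pred (≰⇒> ¬3≤))))

record Reduced (e : Expr) : Set where
  constructor reduced
  field
    i     : ℕ
    core  : Expr
    eval≡ : eval e ≡ 3 ^ i * eval core
    ones≡ : ones e ≡ 3 * i + ones core
    shape : Shape core

reduce : ∀ e → Reduced e
reduce-trivial : ∀ e {v o} → Trivial v o → Reduced e →
                 ∀ e' → eval e' ≡ v * eval e → ones e' ≡ o + ones e → Reduced e'
reduce one = reduced 0 one refl refl (small (s≤s z≤n))
reduce e@(f ⊕ g) with ≤-total (eval g) (eval f)
... | inj₁ h = reduced 0 e (sym (+-identityʳ _)) refl (shape-⊕ e f g h refl refl)
... | inj₂ h = reduced 0 e (sym (+-identityʳ _)) refl (shape-⊕ e g f h (+-comm (eval f) _) (+-comm (ones f) _))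
reduce e@(f ⊗ g) with classify f | classify g
... | inj₁ t | _      = reduce-trivial g t (reduce g) e refl refl
... | inj₂ _ | inj₁ t = reduce-trivial f t (reduce f) e (*-comm (eval f) _) (+-comm (ones f) _)
... | inj₂ c | inj₂ d = reduced 0 e (sym (+-identityʳ _)) refl (prod f g c d refl refl)

reduce-trivial e (j , refl , refl) (reduced i c v o s) e' v' o' = reduced (j + i) c
  (trans v' (trans (cong (3 ^ j *_) v) (trans (sym (*-assoc (3 ^ j) (3 ^ i) _)) (cong (_* eval c) (sym (3^-+ j i))))))
  (trans o' (trans (cong (3 * j +_) o) (trans (sym (+-assoc (3 * j) (3 * i) _))
    (cong (_+ ones c) (sym (*-distribˡ-+ 3 j i))))))
  s

T-bound : ∀ {β x} → T β x → 3 ^ β * cube (num x) ≤ 9 * cube (3 ^ lev x)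
T-bound {β} {x} (rep i e v c) = *-cancelʳ-≤ _ _ (cube (3 ^ i)) {{cube-3^≢0 i}} (begin
  3 ^ β * cube (num x) * cube (3 ^ i)     ≡⟨ *-assoc (3 ^ β) _ _ ⟩
  3 ^ β * (cube (num x) * cube (3 ^ i))   ≡⟨ cong (3 ^ β *_) (cube-* (num x) (3 ^ i)) ⟨
  3 ^ β * cube (num x * 3 ^ i)            ≡⟨ cong (λ z → 3 ^ β * cube z) v ⟩
  3 ^ β * cube (3 ^ lev x * eval e)       ≡⟨ cong (3 ^ β *_) (cube-* (3 ^ lev x) (eval e)) ⟩
  3 ^ β * (cube (3 ^ lev x) * cube (eval e)) ≤⟨ *-monoʳ-≤ (3 ^ β) (*-monoʳ-≤ (cube (3 ^ lev x)) (eval-bound e)) ⟩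
  3 ^ β * (cube (3 ^ lev x) * 3 ^ ones e) ≡⟨ lem (3 ^ β) (cube (3 ^ lev x)) (3 ^ ones e) ⟩
  cube (3 ^ lev x) * (3 ^ ones e * 3 ^ β) ≡⟨ cong (cube (3 ^ lev x) *_) (3^-+ (ones e) β) ⟨
  cube (3 ^ lev x) * 3 ^ (ones e + β)     ≤⟨ *-monoʳ-≤ (cube (3 ^ lev x)) (^-monoʳ-≤ 3 c) ⟩
  cube (3 ^ lev x) * 3 ^ (3 * i + 2)      ≡⟨ cong (cube (3 ^ lev x) *_)
                                               (trans (3^-+ (3 * i) 2) (cong (_* 9) (sym (cube-3^ i)))) ⟩
  cube (3 ^ lev x) * (cube (3 ^ i) * 9)   ≡⟨ lem' (cube (3 ^ lev x)) (cube (3 ^ i)) ⟩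
  9 * cube (3 ^ lev x) * cube (3 ^ i) ∎)
  where
  open ≤-Reasoning
  lem : ∀ a b c → a * (b * c) ≡ b * (c * a)
  lem = solve-∀
  lem' : ∀ a b → a * (b * 9) ≡ 9 * a * b
  lem' = solve-∀

-- 3^(2 - β) / x³ ≤ (9/8)^N, that is, the defect 2 - β - 3 log₃ x is at most N times that of 2.
Large : ℕ → ℕ → Triadic → Set
Large N β x = 8 ^ N * (9 * cube (3 ^ lev x)) ≤ 9 ^ N * (3 ^ β * cube (num x))

Large-mono : ∀ {N β x y} → x ≼ y → Large N β x → Large N β y
Large-mono {N} {β} {x} {y} (le h) l =
  *-cancelʳ-≤ _ _ (cube (3 ^ lev x)) {{cube-3^≢0 (lev x)}}
    (arith (8 ^ N) (9 ^ N) (3 ^ β) (cube (num x)) (cube (num y)) (cube (3 ^ lev x)) (cube (3 ^ lev y)) l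
      (cube-* (num x) (3 ^ lev y)) (cube-mono h) (cube-* (num y) (3 ^ lev x)))
  where
  open ≤-Reasoning
  lem : ∀ a b c → a * (9 * b) * c ≡ a * (9 * c) * b
  lem = solve-∀
  lem' : ∀ a b c d → a * (b * c) * d ≡ a * (b * (c * d))
  lem' = solve-∀
  arith : ∀ a b c x y X Y {u v} → a * (9 * X) ≤ b * (c * x) → u ≡ x * Y → u ≤ v → v ≡ y * X →
          a * (9 * Y) * X ≤ b * (c * y) * X
  arith a b c x y X Y h refl u≤v refl = begin
    a * (9 * Y) * X   ≡⟨ lem a Y X ⟩
    a * (9 * X) * Y   ≤⟨ *-monoˡ-≤ Y h ⟩
    b * (c * x) * Y   ≡⟨ lem' b c x Y ⟩
    b * (c * (x * Y)) ≤⟨ *-monoʳ-≤ b (*-monoʳ-≤ c u≤v) ⟩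
    b * (c * (y * X)) ≡⟨ lem' b c y X ⟨
    b * (c * y) * X   ∎

record Window (N β : ℕ) (x : Triadic) : Set where
  constructor window
  field
    ∈T    : T β x
    large : Large N β x

-- The hypothesis has a factor 9/8 to spare, so the defect is at most N - 1 units. For N = 0 it
-- would be negative, which `T-bound` forbids.
window-pred : ∀ {N β x} → T β x →
  9 * (8 ^ N * (9 * cube (3 ^ lev x))) ≤ 8 * (9 ^ N * (3 ^ β * cube (num x))) →
  ∃ λ N' → N ≡ suc N' × Window N' β x
window-pred {zero} {β} {x} t h =
  ⊥-elim (arith X {{m*n≢0 9 _ {{_}} {{cube-3^≢0 (lev x)}}}} (3 ^ β * cube (num x)) h (T-bound t))
  where
  X = 9 * cube (3 ^ lev x)
  arith : ∀ X .{{_ : NonZero X}} D → 9 * (1 * X) ≤ 8 * (1 * D) → D ≤ X → ⊥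
  arith X D h D≤X = <⇒≱ (*-monoˡ-< X (n<1+n 8)) (subst₂ _≤_ (cong (9 *_) (*-identityˡ X)) (cong (8 *_) (*-identityˡ X))
    (≤-trans h (*-monoʳ-≤ 8 (*-monoʳ-≤ 1 D≤X))))
window-pred {suc N} {β} {x} t h =
  N , refl , window t (arith (8 ^ N) (9 ^ N) (9 * cube (3 ^ lev x)) (3 ^ β * cube (num x)) h)
  where
  open ≤-Reasoning
  lem : ∀ a c → 8 * (9 * (a * c)) ≡ 9 * (8 * a * c)
  lem = solve-∀
  arith : ∀ a b C D → 9 * (8 * a * C) ≤ 8 * (9 * b * D) → a * C ≤ b * D
  arith a b C D h = *-cancelˡ-≤ 9 (*-cancelˡ-≤ 8 (begin
    8 * (9 * (a * C)) ≡⟨ lem a C ⟩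
    9 * (8 * a * C)   ≤⟨ h ⟩
    8 * (9 * b * D)   ≡⟨ cong (8 *_) (*-assoc 9 b D) ⟩
    8 * (9 * (b * D)) ∎))

-- A bounded numerator over 3^j stays above a positive bound only for finitely many j.
small-level : ∀ {N β j v} → v ≤ 3 → Large N β (v /3^ j) → j < suc (9 ^ N * (3 ^ β * 27))
small-level {N} {β} {j} {v} v≤3 l = s≤s (begin
  j                            ≤⟨ <⇒≤ (n<3^n j) ⟩
  3 ^ j                        ≤⟨ n≤cube (3 ^ j) ⟩
  cube (3 ^ j)                 ≤⟨ m≤n*m (cube (3 ^ j)) 9 ⟩
  9 * cube (3 ^ j)             ≤⟨ m≤n*m (9 * cube (3 ^ j)) (8 ^ N) {{m^n≢0 8 N}} ⟩
  8 ^ N * (9 * cube (3 ^ j))   ≤⟨ l ⟩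
  9 ^ N * (3 ^ β * cube v)     ≤⟨ *-monoʳ-≤ (9 ^ N) (*-monoʳ-≤ (3 ^ β) (cube-mono v≤3)) ⟩
  9 ^ N * (3 ^ β * 27)         ∎)
  where open ≤-Reasoning

module _ {N β j : ℕ} (e f g : Expr) where
  open ≤-Reasoning
  private
    C = cube (3 ^ j)
    p = eval f
    r = eval g
    k = ones f
    l = ones g

  incr-window : r ≡ 1 → 3 ≤ p → k + l + β ≤ 3 * j + 2 → Large N β (p + r /3^ j) →
                ∃ λ N' → N ≡ suc N' × Window N' (1 + β) (p /3^ j)
  incr-window r≡1 3≤p c L = window-pred (rep j f (*-comm p _) cost)
    (arith (8 ^ N * (9 * C)) (9 ^ N) (3 ^ β) (cube p) (cube (p + 1))
      (subst (λ r → Large N β (p + r /3^ j)) r≡1 L) (cube-suc 3≤p))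
    where
    lem : ∀ t n b c x → t * (n * (b * (c * x))) ≡ n * (b * (c * (t * x)))
    lem = solve-∀
    lem' : ∀ n b c s x → n * (b * (c * (s * x))) ≡ b * (c * x) * (n * s)
    lem' = solve-∀
    lem'' : ∀ b c x t e → b * (c * x) * (t * (e * 3)) ≡ t * (e * (b * (3 * c * x)))
    lem'' = solve-∀
    arith : ∀ X b c x y → X ≤ b * (c * y) → 27 * y ≤ 64 * x → 9 * X ≤ 8 * (b * (3 * c * x))
    arith X b c x y h k = *-cancelˡ-≤ 27 (begin
      27 * (9 * X)                 ≤⟨ *-monoʳ-≤ 27 (*-monoʳ-≤ 9 h) ⟩
      27 * (9 * (b * (c * y)))     ≡⟨ lem 27 9 b c y ⟩
      9 * (b * (c * (27 * y)))     ≤⟨ *-monoʳ-≤ 9 (*-monoʳ-≤ b (*-monoʳ-≤ c k)) ⟩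
      9 * (b * (c * (64 * x)))     ≡⟨ lem' 9 b c 64 x ⟩
      -- The saved `one` is worth a factor 3, the growth of the cube at most 64/27, and 3 · 27/64 =
      -- 81/64 exceeds the required 9/8.
      b * (c * x) * (9 * 64)       ≤⟨ *-monoʳ-≤ (b * (c * x)) (m≤m+n 576 72) ⟩
      b * (c * x) * (27 * (8 * 3)) ≡⟨ lem'' b c x 27 8 ⟩
      27 * (8 * (b * (3 * c * x))) ∎)
    cost : k + (1 + β) ≤ 3 * j + 2
    cost = begin
      k + (1 + β) ≡⟨ +-assoc k 1 β ⟨
      k + 1 + β   ≤⟨ +-monoˡ-≤ β (+-monoʳ-≤ k (ones≥1 g)) ⟩
      k + l + β   ≤⟨ c ⟩
      3 * j + 2   ∎

  sum-window : 2 ≤ r → r ≤ p → k + l + β ≤ 3 * j + 2 → Large N β (p + r /3^ j) →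
               ∃ λ N' → N ≡ suc N' × Window N' (2 + β) (p /3^ j)
  sum-window 2≤r r≤p c L = window-pred (rep j f (*-comm p _) cost)
    (arith (8 ^ N * (9 * C)) (9 ^ N) (3 ^ β) (cube p) (cube (p + r)) L (cube-sum r≤p))
    where
    lem : ∀ b c x → 9 * (b * (c * (8 * x))) ≡ 8 * (b * (3 * (3 * c) * x))
    lem = solve-∀
    arith : ∀ X b c x y → X ≤ b * (c * y) → y ≤ 8 * x → 9 * X ≤ 8 * (b * (3 * (3 * c) * x))
    arith X b c x y h k = begin
      9 * X                           ≤⟨ *-monoʳ-≤ 9 (≤-trans h (*-monoʳ-≤ b (*-monoʳ-≤ c k))) ⟩
      9 * (b * (c * (8 * x)))         ≡⟨ lem b c x ⟩
      8 * (b * (3 * (3 * c) * x))     ∎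
    cost : k + (2 + β) ≤ 3 * j + 2
    cost = begin
      k + (2 + β) ≡⟨ +-assoc k 2 β ⟨
      k + 2 + β   ≤⟨ +-monoˡ-≤ β (+-monoʳ-≤ k (2≤-exponent 2≤r (eval-bound g))) ⟩
      k + l + β   ≤⟨ c ⟩
      3 * j + 2   ∎

  3^cost : k + l + β ≤ 3 * j + 2 → 3 ^ k * 3 ^ l * 3 ^ β ≤ 9 * C
  3^cost c = begin
    3 ^ k * 3 ^ l * 3 ^ β ≡⟨ trans (3^-+ (k + l) β) (cong (_* 3 ^ β) (3^-+ k l)) ⟨
    3 ^ (k + l + β)       ≤⟨ ^-monoʳ-≤ 3 c ⟩
    3 ^ (3 * j + 2)       ≡⟨ trans (3^-+ (3 * j) 2) (trans (*-comm (3 ^ (3 * j)) 9) (cong (9 *_) (sym (cube-3^ j)))) ⟩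
    9 * C ∎

  -- Since r ≤ p, the sum is at most 2p and its cube at most 8 · 3^k, whereas the cost is k + l. The
  -- defect therefore grows with l, and its upper bound limits 3^l and with it r.
  summand-bound : r ≤ p → k + l + β ≤ 3 * j + 2 → Large N β (p + r /3^ j) → r ≤ 8 * 9 ^ N
  summand-bound r≤p c L = begin
    r             ≤⟨ n≤cube r ⟩
    cube r        ≤⟨ eval-bound g ⟩
    3 ^ l         ≤⟨ m≤n*m (3 ^ l) (8 ^ N) {{m^n≢0 8 N}} ⟩
    8 ^ N * 3 ^ l ≤⟨ arith (8 ^ N) (9 ^ N) (9 * C) {{m*n≢0 9 C {{_}} {{cube-3^≢0 j}}}} (3 ^ β) (3 ^ k) (3 ^ l) (cube (p + r))
                       L (≤-trans (cube-sum r≤p) (*-monoʳ-≤ 8 (eval-bound f))) (3^cost c) ⟩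
    8 * 9 ^ N     ∎
    where
    lem : ∀ b c x y → b * (c * (8 * x)) * y ≡ 8 * b * (x * y * c)
    lem = solve-∀
    arith : ∀ a b X .{{_ : NonZero X}} c x y z → a * X ≤ b * (c * z) → z ≤ 8 * x → x * y * c ≤ X → a * y ≤ 8 * b
    arith a b X c x y z h k m = *-cancelʳ-≤ _ _ X (begin
      a * y * X             ≡⟨ xy∙z≈xz∙y a y X ⟩
      a * X * y             ≤⟨ *-monoˡ-≤ y (≤-trans h (*-monoʳ-≤ b (*-monoʳ-≤ c k))) ⟩
      b * (c * (8 * x)) * y ≡⟨ lem b c x y ⟩
      8 * b * (x * y * c)   ≤⟨ *-monoʳ-≤ (8 * b) m ⟩
      8 * b * X             ∎)

  module _ {j₁ β₁ β₂ : ℕ} (level : k + β₁ ≡ 3 * j₁ + 2) (sum≡ : β₁ + β₂ ≡ β + 2)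
           (c : k + l + β ≤ 3 * j + 2) (L : Large N β (p * r /3^ j)) where
    private C₁ = cube (3 ^ j₁)

    -- Defects add under products, so removing the factor r lowers the defect by that of r, at least
    -- one unit.
    prod-windowˡ : Defective r l → ∃ λ N' → N ≡ suc N' × Window N' β₁ (p /3^ j₁)
    prod-windowˡ d = window-pred (rep j₁ f (*-comm p _) (≤-reflexive level))
      (arith (8 ^ N) (9 ^ N) C {{cube-3^≢0 j}} C₁ (3 ^ β) (3 ^ β₁) (3 ^ l) (cube p) (cube r)
        (subst (λ z → 8 ^ N * (9 * C) ≤ 9 ^ N * (3 ^ β * z)) (cube-* p r) L) d exponents)
      where
      lem : ∀ a X Y → 9 * (a * (9 * Y)) * X ≡ 9 * (a * (9 * X)) * Y
      lem = solve-∀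
      lem' : ∀ b c x y Y → 9 * (b * (c * (x * y))) * Y ≡ b * x * (c * (9 * y) * Y)
      lem' = solve-∀
      lem'' : ∀ b c x z Y → b * x * (c * (8 * z) * Y) ≡ 8 * (b * x) * (c * z * Y)
      lem'' = solve-∀
      lem‴ : ∀ b d x X → 8 * (b * x) * (X * d) ≡ 8 * (b * (d * x)) * X
      lem‴ = solve-∀
      arith : ∀ a b X .{{_ : NonZero X}} Y c d z x y → a * (9 * X) ≤ b * (c * (x * y)) → 9 * y ≤ 8 * z →
              c * z * Y ≤ X * d → 9 * (a * (9 * Y)) ≤ 8 * (b * (d * x))
      arith a b X Y c d z x y h k m = *-cancelʳ-≤ _ _ X (begin
        9 * (a * (9 * Y)) * X           ≡⟨ lem a X Y ⟩
        9 * (a * (9 * X)) * Y           ≤⟨ *-monoˡ-≤ Y (*-monoʳ-≤ 9 h) ⟩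
        9 * (b * (c * (x * y))) * Y     ≡⟨ lem' b c x y Y ⟩
        b * x * (c * (9 * y) * Y)       ≤⟨ *-monoʳ-≤ (b * x) (*-monoˡ-≤ Y (*-monoʳ-≤ c k)) ⟩
        b * x * (c * (8 * z) * Y)       ≡⟨ lem'' b c x z Y ⟩
        8 * (b * x) * (c * z * Y)       ≤⟨ *-monoʳ-≤ (8 * (b * x)) m ⟩
        8 * (b * x) * (X * d)           ≡⟨ lem‴ b d x X ⟩
        8 * (b * (d * x)) * X           ∎)
      exponents : 3 ^ β * 3 ^ l * C₁ ≤ C * 3 ^ β₁
      exponents = begin
        3 ^ β * 3 ^ l * C₁           ≡⟨ cong₂ _*_ (sym (3^-+ β l)) (cube-3^ j₁) ⟩
        3 ^ (β + l) * 3 ^ (3 * j₁)   ≡⟨ 3^-+ (β + l) (3 * j₁) ⟨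
        3 ^ (β + l + 3 * j₁)         ≤⟨ ^-monoʳ-≤ 3 (+-cancelˡ-≤ (k + 2) _ _ (begin
          k + 2 + (β + l + 3 * j₁)     ≡⟨ lem₁ k β l (3 * j₁) ⟩
          k + l + β + (3 * j₁ + 2)     ≤⟨ +-mono-≤ c (≤-reflexive (sym level)) ⟩
          3 * j + 2 + (k + β₁)         ≡⟨ lem₂ (3 * j) k β₁ ⟩
          k + 2 + (3 * j + β₁)         ∎)) ⟩
        3 ^ (3 * j + β₁)             ≡⟨ 3^-+ (3 * j) β₁ ⟩
        3 ^ (3 * j) * 3 ^ β₁         ≡⟨ cong (_* 3 ^ β₁) (cube-3^ j) ⟨
        C * 3 ^ β₁                   ∎
        where
        lem₁ : ∀ k b l i → k + 2 + (b + l + i) ≡ k + l + b + (i + 2)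
        lem₁ = solve-∀
        lem₂ : ∀ j k b → j + 2 + (k + b) ≡ k + 2 + (j + b)
        lem₂ = solve-∀

    private
      shift : β + k ≡ β₂ + 3 * j₁
      shift = +-cancelʳ-≡ 2 _ _ (begin-equality
        β + k + 2         ≡⟨ lem β k ⟩
        (β + 2) + k       ≡⟨ cong (_+ k) sum≡ ⟨
        (β₁ + β₂) + k     ≡⟨ lem' β₁ β₂ k ⟩
        β₂ + (k + β₁)     ≡⟨ cong (β₂ +_) level ⟩
        β₂ + (3 * j₁ + 2) ≡⟨ +-assoc β₂ _ 2 ⟨
        β₂ + 3 * j₁ + 2   ∎)
        where
        lem : ∀ b k → b + k + 2 ≡ (b + 2) + k
        lem = solve-∀
        lem' : ∀ b c k → (b + c) + k ≡ c + (k + b)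
        lem' = solve-∀

    -- The cofactor of p / 3^j₁ is r / 3^(j - j₁); as j₁ may exceed j, the power 3^j₁ is put into
    -- the numerator.
    prod-windowʳ : Defective p k → ∃ λ N' → N ≡ suc N' × Window N' β₂ (3 ^ j₁ * r /3^ j)
    prod-windowʳ d = window-pred
      (rep j (triples j₁ g) (trans (*-comm (3 ^ j₁ * r) _) (cong (3 ^ j *_) (sym (eval-triples j₁ g)))) cost)
      (subst (λ z → 9 * (8 ^ N * (9 * C)) ≤ 8 * (9 ^ N * (3 ^ β₂ * z))) (sym (cube-* (3 ^ j₁) r))
        (arith (8 ^ N * (9 * C)) (9 ^ N) (3 ^ β) (3 ^ β₂) (3 ^ k) C₁ (cube p) (cube r)
          (subst (λ z → 8 ^ N * (9 * C) ≤ 9 ^ N * (3 ^ β * z)) (cube-* p r) L) d exponents))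
      where
      lem : ∀ b c x y → 9 * (b * (c * (x * y))) ≡ b * c * y * (9 * x)
      lem = solve-∀
      lem' : ∀ b c y z → b * c * y * (8 * z) ≡ 8 * (b * (c * z * y))
      lem' = solve-∀
      arith : ∀ A b c d z Y x y → A ≤ b * (c * (x * y)) → 9 * x ≤ 8 * z → c * z ≡ d * Y →
              9 * A ≤ 8 * (b * (d * (Y * y)))
      arith A b c d z Y x y h k m = begin
        9 * A                        ≤⟨ *-monoʳ-≤ 9 h ⟩
        9 * (b * (c * (x * y)))      ≡⟨ lem b c x y ⟩
        b * c * y * (9 * x)          ≤⟨ *-monoʳ-≤ (b * c * y) k ⟩
        b * c * y * (8 * z)          ≡⟨ lem' b c y z ⟩
        8 * (b * (c * z * y))        ≡⟨ cong (λ w → 8 * (b * (w * y))) m ⟩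
        8 * (b * (d * Y * y))        ≡⟨ cong (λ w → 8 * (b * w)) (*-assoc d Y y) ⟩
        8 * (b * (d * (Y * y)))      ∎
      exponents : 3 ^ β * 3 ^ k ≡ 3 ^ β₂ * C₁
      exponents = begin-equality
        3 ^ β * 3 ^ k          ≡⟨ 3^-+ β k ⟨
        3 ^ (β + k)            ≡⟨ cong (3 ^_) shift ⟩
        3 ^ (β₂ + 3 * j₁)      ≡⟨ 3^-+ β₂ (3 * j₁) ⟩
        3 ^ β₂ * 3 ^ (3 * j₁)  ≡⟨ cong (3 ^ β₂ *_) (cube-3^ j₁) ⟨
        3 ^ β₂ * C₁            ∎
      cost : ones (triples j₁ g) + β₂ ≤ 3 * j + 2
      cost = begin
        ones (triples j₁ g) + β₂ ≡⟨ cong (_+ β₂) (ones-triples j₁ g) ⟩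
        3 * j₁ + l + β₂          ≡⟨ lem₁ (3 * j₁) l β₂ ⟩
        l + (β₂ + 3 * j₁)        ≡⟨ cong (l +_) shift ⟨
        l + (β + k)              ≡⟨ lem₂ l β k ⟩
        k + l + β                ≤⟨ c ⟩
        3 * j + 2 ∎
        where
        lem₁ : ∀ j l b → j + l + b ≡ l + (b + j)
        lem₁ = solve-∀
        lem₂ : ∀ l b k → l + (b + k) ≡ k + l + b
        lem₂ = solve-∀

-- Compactness of T β above a positive bound

level-bound : ℕ → ℕ → ℕ
level-bound N β = suc (9 ^ N * (3 ^ β * 27))

addend-bound : ℕ → ℕ
addend-bound N = 8 * 9 ^ N

-- Powers of 3 can be moved between the factors until the first has complexity 0, 1 or 2, so three
-- products of windows cover all cases.
Factored : ℕ → ℕ → Triadic → Set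
Factored N β z = ∃ λ β₁ → β₁ < 3 × (Window N β₁ · Window N (β + 2 ∸ β₁)) z

Composite : ℕ → ℕ → ℕ → Triadic → Set
Composite N N' β z = Translate β (addend-bound N) (Window N' (1 + β)) z ⊎
                     Translate β (addend-bound N) (Window N' (2 + β)) z ⊎ Factored N' β z

split-ones-mod3 : ∀ k → ∃ λ j → ∃ λ β → β < 3 × k + β ≡ 3 * j + 2
split-ones-mod3 0 = 0 , 2 , s≤s (s≤s (s≤s z≤n)) , refl
split-ones-mod3 1 = 0 , 1 , s≤s (s≤s z≤n) , refl
split-ones-mod3 2 = 0 , 0 , s≤s z≤n , refl
split-ones-mod3 (suc (suc (suc k))) with split-ones-mod3 k
... | j , β , h , p = suc j , β , h , trans (cong (3 +_) p) (lem j)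
  where
  lem : ∀ j → 3 + (3 * j + 2) ≡ 3 * (1 + j) + 2
  lem = solve-∀

decompose-shape : ∀ {N β j} z e → z ≋ (eval e /3^ j) → ones e + β ≤ 3 * j + 2 → Large N β (eval e /3^ j) →
  Shape e → LevelBelow β (level-bound N β) z ⊎ (∃ λ N' → N ≡ suc N' × Composite N N' β z)
decompose-shape {N} {β} {j} z e z≋ c L (small v≤3) = inj₁ (j , small-level {N} {β} v≤3 L , e , z≋ , c)
decompose-shape {N} {β} {j} z e z≋ c L (incr f g r≡1 3≤ v o) =
  let N' , N≡ , w = incr-window {N} {β} {j} e f g r≡1 3≤ (subst (λ o → o + β ≤ 3 * j + 2) o c)
                      (subst (λ v → Large N β (v /3^ j)) v L)
  in inj₂ (N' , N≡ , inj₁ (translate w j (eval f) (eval g) e (eq refl) v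
       (subst (_≤ 8 * 9 ^ N) (sym r≡1) (≤-trans (m^n>0 9 N) (m≤n*m (9 ^ N) 8))) c z≋))
decompose-shape {N} {β} {j} z e z≋ c L (sum f g 2≤ ≤f v o) =
  let c' = subst (λ o → o + β ≤ 3 * j + 2) o c
      L' = subst (λ v → Large N β (v /3^ j)) v L
      N' , N≡ , w = sum-window {N} {β} {j} e f g 2≤ ≤f c' L'
  in inj₂ (N' , N≡ , inj₂ (inj₁ (translate w j (eval f) (eval g) e (eq refl) v
       (summand-bound {N} {β} {j} e f g ≤f c' L') c z≋)))
decompose-shape {N} {β} {j} z e z≋ c L (prod f g df dg v o) =
  let c' = subst (λ o → o + β ≤ 3 * j + 2) o c
      L' = subst (λ v → Large N β (v /3^ j)) v L
      j₁ , β₁ , β₁<3 , level = split-ones-mod3 (ones f)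
      sum≡ = m+[n∸m]≡n (≤-trans (≤-pred β₁<3) (m≤n+m 2 β))
      N₁ , N≡₁ , w₁ = prod-windowˡ {N} {β} {j} e f g {j₁} {β₁} {β + 2 ∸ β₁} level sum≡ c' L' dg
      N₂ , N≡₂ , w₂ = prod-windowʳ {N} {β} {j} e f g {j₁} {β₁} {β + 2 ∸ β₁} level sum≡ c' L' df
  in inj₂ (N₁ , N≡₁ , inj₂ (inj₂ (β₁ , β₁<3 , (eval f /3^ j₁) , (3 ^ j₁ * eval g /3^ j) , w₁ ,
       subst (λ n → Window n (β + 2 ∸ β₁) (3 ^ j₁ * eval g /3^ j)) (suc-injective (trans (sym N≡₂) N≡₁)) w₂ ,
       ≋-trans z≋ (eq (trans (cong₂ _*_ v (3^-+ j₁ j)) (lem (eval f) (eval g) (3 ^ j₁) (3 ^ j)))))))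
  where
  lem : ∀ p r a b → p * r * (a * b) ≡ p * (a * r) * b
  lem = solve-∀

-- Cancel the power of 3 split off by `reduce` against the level of the witness, so that the shape
-- of the core applies to `z` itself.
decompose : ∀ {N β} z → Window N β z →
  LevelBelow β (level-bound N β) z ⊎ (∃ λ N' → N ≡ suc N' × Composite N N' β z)
decompose {N} {β} z (window (rep i e v c) L) with reduce e
... | reduced i' e' v' o' s with i' ≤? i
... | yes i'≤i = decompose-shape z e' z≋ cost (Large-mono {N} {β} (≋⇒≼ z≋) L) s
  where
  open ≤-Reasoning
  j = i ∸ i'
  i≡ : i' + j ≡ i
  i≡ = m+[n∸m]≡n i'≤i
  z≋ : z ≋ (eval e' /3^ j)
  z≋ = eq (*-cancelˡ-≡ _ _ (3 ^ i') {{3^≢0 i'}} (begin-equality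
    3 ^ i' * (num z * 3 ^ j)         ≡⟨ lem (3 ^ i') (num z) (3 ^ j) ⟩
    num z * (3 ^ i' * 3 ^ j)         ≡⟨ cong (num z *_) (trans (sym (3^-+ i' j)) (cong (3 ^_) i≡)) ⟩
    num z * 3 ^ i                    ≡⟨ v ⟩
    3 ^ lev z * eval e               ≡⟨ cong (3 ^ lev z *_) v' ⟩
    3 ^ lev z * (3 ^ i' * eval e')   ≡⟨ lem' (3 ^ lev z) (3 ^ i') (eval e') ⟩
    3 ^ i' * (eval e' * 3 ^ lev z)   ∎))
    where
    lem : ∀ a b c → a * (b * c) ≡ b * (a * c)
    lem = solve-∀
    lem' : ∀ a b c → a * (b * c) ≡ b * (c * a)
    lem' = solve-∀
  cost : ones e' + β ≤ 3 * j + 2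
  cost = +-cancelˡ-≤ (3 * i') _ _ (begin
    3 * i' + (ones e' + β) ≡⟨ +-assoc (3 * i') _ β ⟨
    3 * i' + ones e' + β   ≡⟨ cong (_+ β) o' ⟨
    ones e + β             ≤⟨ c ⟩
    3 * i + 2              ≡⟨ cong (λ i → 3 * i + 2) i≡ ⟨
    3 * (i' + j) + 2       ≡⟨ lem i' j ⟩
    3 * i' + (3 * j + 2)   ∎)
    where
    lem : ∀ a b → 3 * (a + b) + 2 ≡ 3 * a + (3 * b + 2)
    lem = solve-∀
-- The power of 3 outweighs the denominator: `z` is an integer and belongs to level 0.
... | no i'≰i = inj₁ (0 , s≤s z≤n , triples j e' , eq z≡ , cost)
  where
  open ≤-Reasoning
  j = i' ∸ i
  i'≡ : i + j ≡ i'
  i'≡ = m+[n∸m]≡n (<⇒≤ (≰⇒> i'≰i))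
  z≡ : num z * 3 ^ 0 ≡ eval (triples j e') * 3 ^ lev z
  z≡ = *-cancelˡ-≡ _ _ (3 ^ i) {{3^≢0 i}} (begin-equality
    3 ^ i * (num z * 1)                    ≡⟨ lem (3 ^ i) (num z) ⟩
    num z * 3 ^ i                          ≡⟨ v ⟩
    3 ^ lev z * eval e                     ≡⟨ cong (3 ^ lev z *_) v' ⟩
    3 ^ lev z * (3 ^ i' * eval e')         ≡⟨ cong (λ t → 3 ^ lev z * (t * eval e'))
                                                 (trans (cong (3 ^_) (sym i'≡)) (3^-+ i j)) ⟩
    3 ^ lev z * (3 ^ i * 3 ^ j * eval e')  ≡⟨ lem' (3 ^ lev z) (3 ^ i) (3 ^ j) (eval e') ⟩
    3 ^ i * (3 ^ j * eval e' * 3 ^ lev z)  ≡⟨ cong (λ t → 3 ^ i * (t * 3 ^ lev z)) (eval-triples j e') ⟨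
    3 ^ i * (eval (triples j e') * 3 ^ lev z) ∎)
    where
    lem : ∀ a b → a * (b * 1) ≡ b * a
    lem = solve-∀
    lem' : ∀ a b c d → a * (b * c * d) ≡ b * (c * d * a)
    lem' = solve-∀
  cost : ones (triples j e') + β ≤ 2
  cost = +-cancelˡ-≤ (3 * i) _ _ (begin
    3 * i + (ones (triples j e') + β)    ≡⟨ cong (λ o → 3 * i + (o + β)) (ones-triples j e') ⟩
    3 * i + (3 * j + ones e' + β)        ≡⟨ lem i j (ones e') β ⟩
    3 * (i + j) + ones e' + β            ≡⟨ cong (λ i → 3 * i + ones e' + β) i'≡ ⟩
    3 * i' + ones e' + β                 ≡⟨ cong (_+ β) o' ⟨
    ones e + β                           ≤⟨ c ⟩
    3 * i + 2 ∎)
    where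
    lem : ∀ i j o b → 3 * i + (3 * j + o + b) ≡ 3 * (i + j) + o + b
    lem = solve-∀

scattered-Window : ∀ N β → Scattered β (Window N β)
scattered-Window N β = union (LevelBelow β (level-bound N β)) (λ z → ∃ λ N' → N ≡ suc N' × Composite N N' β z)
  (scattered-LevelBelow β (level-bound N β)) (composite N) (λ {z} → decompose z)
  where
  composite : ∀ N → Scattered β (λ z → ∃ λ N' → N ≡ suc N' × Composite N N' β z)
  composite zero = none λ { (_ , () , _) }
  composite (suc N) = scattered-⊆ (λ { (_ , refl , p) → p })
    (union (Translate β (addend-bound (suc N)) (Window N (1 + β)))
           (λ z → Translate β (addend-bound (suc N)) (Window N (2 + β)) z ⊎ Factored N β z)
      (scattered-translate (addend-bound (suc N)) (scattered-Window N (1 + β)))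
      (union (Translate β (addend-bound (suc N)) (Window N (2 + β))) (Factored N β)
        (scattered-translate (addend-bound (suc N)) (scattered-weaken (scattered-Window N (2 + β))))
        (scattered-⋃ 3 (λ β₁ → Window N β₁ · Window N (β + 2 ∸ β₁)) λ β₁ β₁<3 →
          scattered-product (m+[n∸m]≡n (≤-trans (≤-pred β₁<3) (m≤n+m 2 β)))
            (scattered-Window N β₁) (scattered-Window N (β + 2 ∸ β₁)))
        (λ p → p))
      (λ p → p))

bernoulli : ∀ N → 8 ^ N * (8 + N) ≤ 9 ^ N * 8
bernoulli zero = ≤-refl
bernoulli (suc N) = arith (8 ^ N) (9 ^ N) N (bernoulli N)
  where
  open ≤-Reasoning
  lem : ∀ a n → 8 * a * (8 + (1 + n)) + a * n ≡ 9 * (a * (8 + n))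
  lem = solve-∀
  arith : ∀ a b n → a * (8 + n) ≤ b * 8 → 8 * a * (8 + suc n) ≤ 9 * b * 8
  arith a b n h = begin
    8 * a * (8 + suc n)           ≤⟨ m≤m+n _ (a * n) ⟩
    8 * a * (8 + suc n) + a * n   ≡⟨ lem a n ⟩
    9 * (a * (8 + n))             ≤⟨ *-monoʳ-≤ 9 h ⟩
    9 * (b * 8)                   ≡⟨ *-assoc 9 b 8 ⟨
    9 * b * 8                     ∎

-- By Bernoulli, (9/8)^(8A) ≥ 1 + A. Hence every positive lower bound is absorbed by some window.
8^N*A≤9^N*D : ∀ A D → 1 ≤ D → ∃ λ N → 8 ^ N * A ≤ 9 ^ N * D
8^N*A≤9^N*D A D 1≤D = 8 * A , arith (8 ^ (8 * A)) (9 ^ (8 * A)) (bernoulli (8 * A))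
  where
  open ≤-Reasoning
  lem : ∀ a A → a * (8 * A) ≡ 8 * (a * A)
  lem = solve-∀
  arith : ∀ a b → a * (8 + 8 * A) ≤ b * 8 → a * A ≤ b * D
  arith a b h = *-cancelˡ-≤ 8 (begin
    8 * (a * A)      ≡⟨ lem a A ⟨
    a * (8 * A)      ≤⟨ *-monoʳ-≤ a (m≤n+m (8 * A) 8) ⟩
    a * (8 + 8 * A)  ≤⟨ h ⟩
    b * 8            ≡⟨ *-comm b 8 ⟩
    8 * b            ≤⟨ *-monoʳ-≤ 8 (m≤m*n b D {{>-nonZero 1≤D}}) ⟩
    8 * (b * D)      ∎)

large-exists : ∀ β x → 1 ≤ num x → ∃ λ N → Large N β x
large-exists β x 1≤n = 8^N*A≤9^N*D (9 * cube (3 ^ lev x)) (3 ^ β * cube (num x)) (*-mono-≤ (m^n>0 3 β) (cube-mono 1≤n))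

Above : ℕ → Triadic → Triadic → Set
Above β x₀ x = T β x × x₀ ≼ x

-- Abstract, since these terms are far too large to be normalised.
abstract
  scattered-above : ∀ β x₀ → 1 ≤ num x₀ → Scattered β (Above β x₀)
  scattered-above β x₀ pos =
    let N , L = large-exists β x₀ pos
    in scattered-⊆ (λ { (t , h) → window t (Large-mono {N} {β} h L) }) (scattered-Window N β)

-- By `T-bound`, 3^β ≤ 9 / x₀³ ≤ 9 · 3^(3 lev x₀). This bounds the ranks that occur above x₀.
T-above-empty : ∀ {x₀ β x} → 1 ≤ num x₀ → 9 * cube (3 ^ lev x₀) ≤ β → x₀ ≼ x → ¬ T β x
T-above-empty {x₀} {β} {x} pos B≤β (le h) t = <⇒≱ (n<3^n β)
  (≤-trans (arith (3 ^ β) (cube (num x)) (cube (num x₀)) (cube (3 ^ lev x)) {{cube-3^≢0 (lev x)}} (cube (3 ^ lev x₀))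
     (T-bound t) (subst₂ _≤_ (cube-* (num x₀) (3 ^ lev x)) (cube-* (num x) (3 ^ lev x₀)) (cube-mono h)) (cube-mono pos)) B≤β)
  where
  open ≤-Reasoning
  lem : ∀ b y Y → b * y * Y ≡ b * (y * Y)
  lem = solve-∀
  lem' : ∀ X Y → 9 * X * Y ≡ 9 * Y * X
  lem' = solve-∀
  arith : ∀ b x y X .{{_ : NonZero X}} Y → b * x ≤ 9 * X → y * X ≤ x * Y → 1 ≤ y → b ≤ 9 * Y
  arith b x y X Y h k 1≤y = *-cancelʳ-≤ _ _ X (begin
    b * X         ≡⟨ cong (b *_) (*-identityˡ X) ⟨
    b * (1 * X)   ≤⟨ *-monoʳ-≤ b (*-monoˡ-≤ X 1≤y) ⟩
    b * (y * X)   ≤⟨ *-monoʳ-≤ b k ⟩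
    b * (x * Y)   ≡⟨ *-assoc b x Y ⟨
    b * x * Y     ≤⟨ *-monoˡ-≤ Y h ⟩
    9 * X * Y     ≡⟨ lem' X Y ⟩
    9 * Y * X     ∎)

-- It plays the part of infinity: x³ ≤ 9 on every `T β`, and 4³ exceeds 9.
top : Triadic
top = 4 /3^ 0

T≺top : ∀ {β x} → T β x → x ≺ top
T≺top {β} {x} t with ≼? top x
... | inj₂ h = h
... | inj₁ (le h) = ⊥-elim (arith (3 ^ β) (cube (num x)) (cube (3 ^ lev x)) {{cube-3^≢0 (lev x)}} (m^n>0 3 β) (T-bound t)
    (subst₂ _≤_ (cube-* 4 (3 ^ lev x)) (cong cube (*-identityʳ (num x))) (cube-mono h)))
  where
  open ≤-Reasoning
  arith : ∀ b x X .{{_ : NonZero X}} → 1 ≤ b → b * x ≤ 9 * X → 64 * X ≤ x → ⊥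
  arith b x X 1≤b h k = <⇒≱ (*-monoˡ-< X (m≤m+n 10 54)) (begin
    64 * X ≤⟨ k ⟩
    x      ≤⟨ m≤n*m x b {{>-nonZero 1≤b}} ⟩
    b * x  ≤⟨ h ⟩
    9 * X  ∎)

T-pos : ∀ {β x} → T β x → 1 ≤ num x
T-pos {x = zero /3^ l} (rep i e v c) =
  ⊥-elim (<⇒≱ (*-mono-≤ (m^n>0 3 l) (eval≥1 e)) (≤-reflexive (sym v)))
T-pos {x = suc n /3^ l} _ = s≤s z≤n

≺-pos : ∀ {x q} → x ≺ q → 1 ≤ num q
≺-pos {q = zero /3^ l} (lt ())
≺-pos {q = suc n /3^ l} _ = s≤s z≤n

-- The witness 3^-t, written as 3 / 3^(t + 1), is cheap enough because t ≥ β and below q because t >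
-- lev q. It supplies the positive bound above which the greatest element is sought.
T-small : ∀ β q → 1 ≤ num q → ∃ λ x → T β x × x ≺ q
T-small β q pos = x , rep (suc t) (one ⊕ (one ⊕ one)) (lem (3 ^ t)) (begin
    3 + β            ≤⟨ +-monoʳ-≤ 3 (≤-trans (m≤m+n β (lev q + 1)) (m≤n*m t 3)) ⟩
    3 + 3 * t        ≡⟨ *-suc 3 t ⟨
    3 * suc t        ≤⟨ m≤m+n _ 2 ⟩
    3 * suc t + 2    ∎) , lt (begin-strict
    1 * 3 ^ lev q    ≡⟨ *-identityˡ _ ⟩
    3 ^ lev q        <⟨ ^-monoʳ-< 3 (s≤s (s≤s z≤n)) (m<n+m (lev q) {β + 1} (m≤n+m 1 β)) ⟩
    3 ^ (β + 1 + lev q) ≡⟨ cong (3 ^_) (lem' β (lev q)) ⟩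
    3 ^ t            ≤⟨ m≤n*m (3 ^ t) (num q) {{>-nonZero pos}} ⟩
    num q * 3 ^ t    ∎)
  where
  open ≤-Reasoning
  t = β + (lev q + 1)
  x = 1 /3^ t
  lem : ∀ a → 1 * (3 * a) ≡ a * 3
  lem = solve-∀
  lem' : ∀ b l → b + 1 + l ≡ b + (l + 1)
  lem' = solve-∀

-- Greatest elements below a given number

-- Membership of p is required in `T β`, not in X: a cover gives points of `T β` without deciding
-- whether they belong to X. For X = `T β` this is the true maximum.
record Greatest (β : ℕ) (X : Triadic → Set) (q p : Triadic) : Set where
  field
    ∈T   : T β p
    ≺q   : p ≺ q
    ≼p   : ∀ {x} → X x → x ≺ q → x ≼ p
open Greatest

greatest : ∀ {β X} → Scattered β X → ∀ q → (∀ {x} → X x → ¬ x ≺ q) ⊎ (∃ λ p → Greatest β X q p)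
greatest (none n) q = inj₁ λ p → ⊥-elim (n p)
greatest (point v t s) q with ≼? q v
... | inj₁ q≼v = inj₁ λ p → ≼⇒⊁ (≼-trans q≼v (≋⇒≽ (s p)))
... | inj₂ v≺q = inj₂ (v , record { ∈T = t ; ≺q = v≺q ; ≼p = λ p _ → ≋⇒≼ (s p) })
greatest {β} {X} (union Y Z a b s) q with greatest a q | greatest b q
... | inj₁ m | inj₁ n = inj₁ both
  where
  both : ∀ {x} → X x → ¬ x ≺ q
  both p with s p
  ... | inj₁ y = m y
  ... | inj₂ z = n z
... | inj₁ m | inj₂ (w , g) = inj₂ (w , record { ∈T = ∈T g ; ≺q = ≺q g ; ≼p = both })
  where
  both : ∀ {x} → X x → x ≺ q → x ≼ w
  both p h with s p
  ... | inj₁ y = ⊥-elim (m y h)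
  ... | inj₂ z = ≼p g z h
... | inj₂ (w , g) | inj₁ n = inj₂ (w , record { ∈T = ∈T g ; ≺q = ≺q g ; ≼p = both })
  where
  both : ∀ {x} → X x → x ≺ q → x ≼ w
  both p h with s p
  ... | inj₁ y = ≼p g y h
  ... | inj₂ z = ⊥-elim (n z h)
... | inj₂ (w , g) | inj₂ (w' , g') with ≼? w w'
...   | inj₁ w≼w' = inj₂ (w' , record { ∈T = ∈T g' ; ≺q = ≺q g' ; ≼p = both })
  where
  both : ∀ {x} → X x → x ≺ q → x ≼ w'
  both p h with s p
  ... | inj₁ y = ≼-trans (≼p g y h) w≼w'
  ... | inj₂ z = ≼p g' z h
...   | inj₂ w'≺w = inj₂ (w , record { ∈T = ∈T g ; ≺q = ≺q g ; ≼p = both })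
  where
  both : ∀ {x} → X x → x ≺ q → x ≼ w
  both p h with s p
  ... | inj₁ y = ≼p g y h
  ... | inj₂ z = ≼-trans (≼p g' z h) (≺⇒≼ w'≺w)
greatest {β} {X} (limit v t l c) q with ≼? q v
... | inj₁ q≼v = inj₁ λ p → ≼⇒⊁ (≼-trans q≼v (l p))
... | inj₂ v≺q = inj₂ (choose (greatest (c (i + suc (lev q))) q))
  where
  i = proj₁ (T-bump t)
  bump∈T = proj₂ (T-bump t)
  w = bump v (i + suc (lev q))
  w≺q : w ≺ q
  w≺q = ≺-≼-trans (bump-anti v (m≤n+m (suc (lev q)) i)) (≺⇒bump≼ v≺q)
  X' = λ x → X x × w ≼ x
  choose : (∀ {x} → X' x → ¬ x ≺ q) ⊎ (∃ λ p → Greatest β X' q p) → ∃ λ p → Greatest β X q p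
  choose (inj₁ n) = w , record { ∈T = bump∈T (suc (lev q)) ; ≺q = w≺q ; ≼p = bound }
    where
    bound : ∀ {x} → X x → x ≺ q → x ≼ w
    bound {x} p h with ≼? w x
    ... | inj₁ w≼x = ⊥-elim (n (p , w≼x) h)
    ... | inj₂ x≺w = ≺⇒≼ x≺w
  choose (inj₂ (p , g)) with ≼? w p
  ... | inj₁ w≼p = p , record { ∈T = ∈T g ; ≺q = ≺q g ; ≼p = bound }
    where
    bound : ∀ {x} → X x → x ≺ q → x ≼ p
    bound {x} xX h with ≼? w x
    ... | inj₁ w≼x = ≼p g (xX , w≼x) h
    ... | inj₂ x≺w = ≼-trans (≺⇒≼ x≺w) w≼p
  ... | inj₂ p≺w = w , record { ∈T = bump∈T (suc (lev q)) ; ≺q = w≺q ; ≼p = bound }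
    where
    bound : ∀ {x} → X x → x ≺ q → x ≼ w
    bound {x} xX h with ≼? w x
    ... | inj₁ w≼x = ≼-trans (≼p g (xX , w≼x) h) (≺⇒≼ p≺w)
    ... | inj₂ x≺w = ≺⇒≼ x≺w

greatest-below : ∀ β q → 1 ≤ num q → ∃ λ p → Greatest β (T β) q p
greatest-below β q pos = found (greatest (scattered-above β x (T-pos t)) q)
  where
  x = proj₁ (T-small β q pos)
  t = proj₁ (proj₂ (T-small β q pos))
  x≺q = proj₂ (proj₂ (T-small β q pos))
  found : (∀ {y} → Above β x y → ¬ y ≺ q) ⊎ (∃ λ p → Greatest β (Above β x) q p) →
          ∃ λ p → Greatest β (T β) q p
  found (inj₁ n) = ⊥-elim (n (t , ≼-refl) x≺q)
  found (inj₂ (p , g)) = p , record { ∈T = ∈T g ; ≺q = ≺q g ; ≼p = bound }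
    where
    bound : ∀ {y} → T β y → y ≺ q → y ≼ p
    bound {y} u y≺q with ≼? x y
    ... | inj₁ x≼y = ≼p g (u , x≼y) y≺q
    ... | inj₂ y≺x = ≼-trans (≺⇒≼ y≺x) (≼p g (t , ≼-refl) x≺q)

abstract
  -- The greatest element of T β below q (junk if q is zero).
  below : ℕ → Triadic → Triadic
  below β (zero /3^ l)    = zero /3^ l
  below β q@(suc n /3^ l) = proj₁ (greatest-below β q (s≤s z≤n))

  below-greatest : ∀ β q → 1 ≤ num q → Greatest β (T β) q (below β q)
  below-greatest β (zero /3^ l) ()
  below-greatest β q@(suc n /3^ l) _ = proj₂ (greatest-below β q (s≤s z≤n))

-- The stable complexity is exactly 2 - α.
record Isolated (α : ℕ) (x : Triadic) : Set where
  constructor isolated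
  field
    in-T  : T α x
    not-T : ¬ T (suc α) x
open Isolated

-- Points of T (1 + β) are limits of T β from above, so they are never the greatest below anything.
below-isolated : ∀ β q → 1 ≤ num q → Isolated β (below β q)
below-isolated β q pos = isolated (∈T g) λ t →
  let i , bump∈T = T-bump t
      s = suc (lev q)
  in ≼⇒⊁ (≼p g (bump∈T s) (≺-≼-trans (bump-anti (below β q) (m≤n+m s i)) (≺⇒bump≼ (≺q g)))) (≺-bump (below β q) (i + s))
  where g = below-greatest β q pos

-- The inequality is strict because the greatest element is never in `T (suc β)`.
≺-below : ∀ {β z} q → z ≺ q → T (suc β) z → z ≺ below β q
≺-below {β} {z} q z≺q t with ≼? (below β q) z
... | inj₂ h = h
... | inj₁ h = ⊥-elim (not-T (below-isolated β q (≺-pos z≺q))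
  (T-resp (≼-antisym (≼p (below-greatest β q (≺-pos z≺q)) (T-anti (n≤1+n β) t) z≺q) h) t))

-- Finiteness where there are no limit points

-- Strictly decreasing chains of X between x and q, with x allowed and q excluded, have at most n
-- members. Chains measure finiteness without listing X or deciding membership.
Short : (Triadic → Set) → Triadic → ℕ → Triadic → Set
Short X x zero    q = ∀ {z} → X z → x ≼ z → ¬ z ≺ q
Short X x (suc n) q = ∀ {z} → X z → x ≼ z → z ≺ q → Short X x n z

module _ {x : Triadic} where

  short-mono : ∀ {X q q'} n → q' ≼ q → Short X x n q → Short X x n q'
  short-mono zero    h s p x≼z z≺q' = s p x≼z (≺-≼-trans z≺q' h)
  short-mono (suc n) h s p x≼z z≺q' = s p x≼z (≺-≼-trans z≺q' h)

  short-⊆ : ∀ {X Y q} n → (∀ {z} → X z → x ≼ z → Y z) → Short Y x n q → Short X x n q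
  short-⊆ zero    X⊆Y s p x≼z h = s (X⊆Y p x≼z) x≼z h
  short-⊆ (suc n) X⊆Y s p x≼z h = short-⊆ n X⊆Y (s (X⊆Y p x≼z) x≼z h)

  -- A chain in the union splits into a chain in each part.
  short-union : ∀ {X Y Z} → (∀ {z} → X z → Y z ⊎ Z z) →
                ∀ n m {q} → Short Y x n q → Short Z x m q → Short X x (n + m) q
  short-union u zero zero s r p x≼z h = [ (λ y → s y x≼z h) , (λ w → r w x≼z h) ]′ (u p)
  short-union {Y = Y} u zero (suc m) s r p x≼z h =
    [ (λ y → ⊥-elim (s y x≼z h))
    , (λ w → short-union u zero m (short-mono {Y} zero (≺⇒≼ h) s) (r w x≼z h)) ]′ (u p)
  short-union {Z = Z} u (suc n) zero s r p x≼z h =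
    [ (λ y → short-union u n zero (s y x≼z h) (short-mono {Z} zero (≺⇒≼ h) r))
    , (λ w → ⊥-elim (r w x≼z h)) ]′ (u p)
  short-union {X} {Y} {Z} u (suc n) (suc m) s r {z} p x≼z h =
    [ (λ y → short-union u n (suc m) (s y x≼z h) (short-mono {Z} (suc m) (≺⇒≼ h) r))
    , (λ w → subst (λ k → Short X x k z) (sym (+-suc n m))
               (short-union u (suc n) m (short-mono {Y} (suc n) (≺⇒≼ h) s) (r w x≼z h))) ]′ (u p)

  -- A limit point v ≥ x would be a forbidden point of `T (suc β)` as soon as X had an element below
  -- q. If v is below x, all of X from x on lies above a fixed bump of v.
  short : ∀ {β X q} → Scattered β X → (∀ {z} → T (suc β) z → x ≼ z → ¬ z ≺ q) → ∃ λ n → Short X x n q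
  short (none n) h = 0 , λ p → ⊥-elim (n p)
  short (point v t s) h = 1 , λ p _ _ p' _ z'≺z → ≼⇒⊁ (≼-trans (≋⇒≼ (s p)) (≋⇒≽ (s p'))) z'≺z
  short (union Y Z a b s) h with short a h | short b h
  ... | n , r | m , r' = n + m , short-union s n m r r'
  short {q = q} (limit v t l c) h with ≼? x v
  ... | inj₁ x≼v = 0 , λ p _ z≺q → h t x≼v (≼-≺-trans (l p) z≺q)
  ... | inj₂ v≺x with short (c (lev x)) h
  ...   | n , r = n , short-⊆ n (λ p x≼z → p , ≼-trans (≺⇒bump≼ v≺x) x≼z) r

-- Positions as Cantor normal forms

Sorted : List ℕ → Set
Sorted = Linked (λ x y → y ≤ x)

-- Going down to the next point of `T (k + α)` accounts for a summand ω^k; the last `below` picks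
-- the element at the position reached.
walk : ℕ → Triadic → List ℕ → Triadic
walk α q []      = below α q
walk α q (k ∷ l) = walk α (below (k + α) q) l

below-pos : ∀ β q → 1 ≤ num q → 1 ≤ num (below β q)
below-pos β q pos = T-pos (∈T (below-greatest β q pos))

walk-isolated : ∀ α q l → 1 ≤ num q → Isolated α (walk α q l)
walk-isolated α q []      pos = below-isolated α q pos
walk-isolated α q (k ∷ l) pos = walk-isolated α (below (k + α) q) l (below-pos (k + α) q pos)

walk-≺ : ∀ α q l → 1 ≤ num q → walk α q l ≺ q
walk-≺ α q []      pos = ≺q (below-greatest α q pos)
walk-≺ α q (k ∷ l) pos = ≺-trans (walk-≺ α (below (k + α) q) l (below-pos (k + α) q pos))
                           (≺q (below-greatest (k + α) q pos))

-- A point of rank at least k' cannot be passed by steps of lower rank, as each of them stops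
-- strictly above it.
≺-walk : ∀ {α q z k k'} l → k < k' → T (k' + α) z → z ≺ q → Sorted (k ∷ l) → z ≺ walk α q l
≺-walk {α} {q} {k' = k'} [] k<k' t z≺q _ =
  ≺-below q z≺q (T-anti (+-monoˡ-≤ α (≤-trans (s≤s z≤n) k<k')) t)
≺-walk {α} {q} (j ∷ l) k<k' t z≺q (j≤k ∷ s) =
  ≺-walk l j<k' t (≺-below q z≺q (T-anti (+-monoˡ-≤ α j<k') t)) s
  where j<k' = <-≤-trans (s≤s j≤k) k<k'

walk-anti : ∀ {α q l l'} → 1 ≤ num q → Sorted l → Sorted l' → l <ω l' → walk α q l' ≺ walk α q l
walk-anti {α} {q} {l' = k ∷ l'} pos _ _ []<∷ =
  ≺-≼-trans (walk-≺ α (below (k + α) q) l' (below-pos (k + α) q pos))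
    (≼p (below-greatest α q pos) (T-anti (m≤n+m α k) (∈T g)) (≺q g))
  where g = below-greatest (k + α) q pos
-- The point p reached by the step k' separates the walks: one continues below p, the other has only
-- smaller exponents and stays above p.
walk-anti {α} {q} {k ∷ l} {k' ∷ l'} pos s _ (head< k<k') =
  ≺-trans (walk-≺ α p l' (below-pos (k' + α) q pos))
    (≺-walk l k<k' (∈T g) (≺-below q (≺q g) (T-anti (+-monoˡ-≤ α k<k') (∈T g))) s)
  where
  p = below (k' + α) q
  g = below-greatest (k' + α) q pos
walk-anti {α} {q} {k ∷ l} pos s s' (tail< h) =
  walk-anti (below-pos (k + α) q pos) (tail s) (tail s') h

module Find {α : ℕ} {x : Triadic} (iso : Isolated α x) where

  NoLimit : ℕ → Triadic → Set
  NoLimit k q = ∀ {z} → T (suc (k + α)) z → x ≼ z → ¬ z ≺ q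

  Found : ℕ → Triadic → Set
  Found k q = ∃ λ l → Sorted (k ∷ l) × walk α q l ≋ x

  weaken : ∀ {k q} → Found k q → Found (suc k) q
  weaken (l , [-] , e)   = l , [-] , e
  weaken (l , h ∷ s , e) = l , m≤n⇒m≤1+n h ∷ s , e

  p : ℕ → Triadic → Triadic
  p k q = below (k + α) q

  -- Greedy expansion, with k bounding the next exponent. If the next point of `T (k + α)` is below
  -- x, then k decreases; if it is above x, k becomes an exponent and the search resumes there with
  -- a shorter chain. `NoLimit` makes the chains finite, so the pair (k, n) decreases
  -- lexicographically.
  find     : ∀ k q → x ≺ q → NoLimit k q → Found k q
  step     : ∀ k n q → x ≺ q → NoLimit k q → Short (Above (k + α) x) x n q → Found k q
  step-≺   : ∀ k q → x ≺ q → Greatest (k + α) (T (k + α)) q (p k q) → p k q ≺ x → Found k q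
  step-≽   : ∀ k n q → x ≺ q → NoLimit k q → Short (Above (k + α) x) x n q →
             Greatest (k + α) (T (k + α)) q (p k q) → x ≼ p k q → Found k q
  step-≋   : ∀ k q → Greatest (k + α) (T (k + α)) q (p k q) → p k q ≋ x → Found k q

  find k q x≺q h =
    let n , s = short (scattered-above (k + α) x (T-pos (in-T iso))) h in step k n q x≺q h s

  step k n q x≺q h s =
    [ step-≽ k n q x≺q h s g , step-≺ k q x≺q g ]′ (≼? x (p k q))
    where g = below-greatest (k + α) q (≺-pos x≺q)

  step-≺ zero    q x≺q g p≺x = ⊥-elim (≼⇒⊁ (≼p g (in-T iso) x≺q) p≺x)
  step-≺ (suc k) q x≺q g p≺x =
    weaken {q = q} (find k q x≺q λ t x≼z z≺q → ≼⇒⊁ (≼-trans x≼z (≼p g t z≺q)) p≺x)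

  step-≽ k zero    q x≺q h s g x≼p = ⊥-elim (s (∈T g , x≼p) x≼p (≺q g))
  step-≽ k (suc n) q x≺q h s g x≼p =
    [ (λ p≼x → step-≋ k q g (≼-antisym p≼x x≼p))
    , (λ x≺p → let l , s' , e = step k n (p k q) x≺p (λ t x≼z z≺p → h t x≼z (≺-trans z≺p (≺q g)))
                                  (s (∈T g , x≼p) x≼p (≺q g))
               in k ∷ l , ≤-refl ∷ s' , e) ]′ (≼? (p k q) x)

  step-≋ zero    q g e = [] , [-] , e
  step-≋ (suc k) q g e = ⊥-elim (not-T iso (T-resp e (T-anti (s≤s (m≤n+m α k)) (∈T g))))

code : ∀ {α x} → Isolated α x → ∃ λ l → Sorted l × walk α top l ≋ x
code {α} {x} iso =
  let l , s , e = Find.find iso B top (T≺top (in-T iso))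
                    (λ t x≼z _ → T-above-empty (T-pos (in-T iso)) (≤-trans (m≤m+n B α) (n≤1+n _)) x≼z t)
  in l , tail s , e
  where B = 9 * cube (3 ^ lev x)

-- The ordinal ω^ω

<ω-compare : ∀ l l' → l <ω l' ⊎ l ≡ l' ⊎ l' <ω l
<ω-compare []      []       = inj₂ (inj₁ refl)
<ω-compare []      (_ ∷ _)  = inj₁ []<∷
<ω-compare (_ ∷ _) []       = inj₂ (inj₂ []<∷)
<ω-compare (x ∷ l) (y ∷ l') with <-cmp x y
... | tri< x<y _ _ = inj₁ (head< x<y)
... | tri> _ _ y<x = inj₂ (inj₂ (head< y<x))
... | tri≈ _ refl _ with <ω-compare l l'
...   | inj₁ h           = inj₁ (tail< h)
...   | inj₂ (inj₁ refl) = inj₂ (inj₁ refl)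
...   | inj₂ (inj₂ h)    = inj₂ (inj₂ (tail< h))

-- The order on all lists is not well-founded, as 1, then 0 1, then 0 0 1 and so on descend forever;
-- sortedness has to be part of the relation.
_<ₛ_ : List ℕ → List ℕ → Set
l <ₛ l' = Sorted l × l <ω l'

data HeadBelow (k : ℕ) : List ℕ → Set where
  []  : HeadBelow k []
  _∷_ : ∀ {x} → x < k → ∀ l → HeadBelow k (x ∷ l)

acc-∷ : ∀ x {l} → (∀ l' → Sorted l' → HeadBelow x l' → Acc _<ₛ_ l') → Acc _<ₛ_ l → Acc _<ₛ_ (x ∷ l)
acc-∷ x h (acc rs) = acc λ where
  (_ , []<∷)               → acc λ { (_ , ()) }
  {_ ∷ l'} (s , head< y<x) → h _ s (y<x ∷ l')
  (s , tail< l'<l)         → acc-∷ x h (rs (tail s , l'<l))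

-- The outer induction is on a strict bound k for the leading exponent, the inner one on the list.
<ₛ-acc : ∀ k l → Sorted l → HeadBelow k l → Acc _<ₛ_ l
<ₛ-acc k       []      _ _ = acc λ { (_ , ()) }
<ₛ-acc (suc k) (x ∷ l) s (x<1+k ∷ _) = acc-∷ x
  (λ l' s' h → <ₛ-acc k l' s' (raise h))
  (<ₛ-acc (suc k) l (tail s) (next s))
  where
  raise : ∀ {l} → HeadBelow x l → HeadBelow k l
  raise []        = []
  raise (y<x ∷ l) = <-≤-trans y<x (≤-pred x<1+k) ∷ l
  next : ∀ {l} → Sorted (x ∷ l) → HeadBelow (suc k) l
  next [-]             = []
  next {_ ∷ l} (h ∷ _) = ≤-<-trans h x<1+k ∷ l

sorted-acc : ∀ l → Sorted l → Acc _<ₛ_ l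
sorted-acc []      s = <ₛ-acc 0 [] s []
sorted-acc (x ∷ l) s = <ₛ-acc (suc x) (x ∷ l) s (≤-refl ∷ l)

module _ {α x y} (ix : Isolated α x) (iy : Isolated α y) where

  private
    walk-x = proj₂ (proj₂ (code ix))
    walk-y = proj₂ (proj₂ (code iy))

  code-reflects : proj₁ (code ix) <ω proj₁ (code iy) → y ≺ x
  code-reflects h = ≼-≺-trans (≋⇒≽ walk-y) (≺-≼-trans
    (walk-anti (s≤s z≤n) (proj₁ (proj₂ (code ix))) (proj₁ (proj₂ (code iy))) h) (≋⇒≼ walk-x))

  code-injective : proj₁ (code ix) ≡ proj₁ (code iy) → x ≋ y
  code-injective h = ≋-trans (≋-sym walk-x) (subst (λ l → walk α top l ≋ y) (sym h) walk-y)

code-preserves : ∀ {α x y} (ix : Isolated α x) (iy : Isolated α y) →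
                 y ≺ x → proj₁ (code ix) <ω proj₁ (code iy)
code-preserves ix iy y≺x = [ (λ h → h) , [ (λ e → ⊥-elim (≼⇒⊁ (≋⇒≼ (code-injective ix iy e)) y≺x))
                                        , (λ h → ⊥-elim (≼⇒⊁ (≺⇒≼ y≺x) (code-reflects iy ix h))) ]′ ]′
                           (<ω-compare (proj₁ (code ix)) (proj₁ (code iy)))

code-unique : ∀ {α x} (ix : Isolated α x) l → Sorted l → walk α top l ≋ x → proj₁ (code ix) ≡ l
code-unique {α} {x} ix l s e = [ (λ h → ⊥-elim (absurd (walk-anti pos s' s h) e e'))
                     , [ (λ h → h) , (λ h → ⊥-elim (absurd (walk-anti pos s s' h) e' e)) ]′ ]′
                     (<ω-compare (proj₁ (code ix)) l)
  where
  pos : 1 ≤ 4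
  pos = s≤s z≤n
  s' = proj₁ (proj₂ (code ix))
  e' = proj₂ (proj₂ (code ix))
  absurd : ∀ {u v} → u ≺ v → u ≋ x → ¬ v ≋ x
  absurd h u v = ≼⇒⊁ (≼-trans (≋⇒≼ v) (≋⇒≽ u)) h

-- Stable numbers

record StableNumber (a : ℕ) : Set where
  constructor stableNumber
  field
    n k    : ℕ
    cpx    : Cpx n k
    mod    : k % 3 ≡ a
    stable : Stable n

value : ∀ {a} → StableNumber a → Triadic
value s = StableNumber.n s /3^ StableNumber.k s / 3

module _ {a α : ℕ} (a+α : a + α ≡ 2) where
  open ≤-Reasoning

  -- A witness cheaper than k, multiplied up by powers of 3, would write some 3^i n with fewer than
  -- 3i + k ones, against stability.
  value-isolated : (s : StableNumber a) → Isolated α (value s)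
  value-isolated (stableNumber n k cpx@((e , refl , refl) , _) mod stable) =
    isolated (rep j e (*-comm n _) (≤-reflexive cost)) λ { (rep i f v c) → too-cheap i f v c }
    where
    j = k / 3
    k≡ : k ≡ 3 * j + a
    k≡ = trans (m≡m%n+[m/n]*n k 3) (trans (cong₂ _+_ mod (*-comm j 3)) (+-comm a (3 * j)))
    cost : k + α ≡ 3 * j + 2
    cost = begin-equality
      k + α           ≡⟨ cong (_+ α) k≡ ⟩
      3 * j + a + α   ≡⟨ +-assoc (3 * j) a α ⟩
      3 * j + (a + α) ≡⟨ cong (3 * j +_) a+α ⟩
      3 * j + 2       ∎
    scaled : ∀ i → Cpx (3 ^ i * n) (3 * i + k)
    scaled zero    = subst (λ m → Cpx m k) (sym (*-identityˡ n)) cpx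
    scaled (suc i) = stable k cpx (suc i) (s≤s z≤n)
    too-cheap : ∀ i f → n * 3 ^ i ≡ 3 ^ j * eval f → ¬ ones f + suc α ≤ 3 * i + 2
    too-cheap i f v c = 1+n≰n (begin
      suc (3 * i + k + α)              ≡⟨ +-suc (3 * i + k) α ⟨
      3 * i + k + suc α                ≤⟨ +-monoˡ-≤ (suc α) (proj₂ (scaled i) (triples j f)
                                            (trans (eval-triples j f) (trans (sym v) (*-comm n _)))) ⟩
      ones (triples j f) + suc α       ≡⟨ cong (_+ suc α) (ones-triples j f) ⟩
      3 * j + ones f + suc α           ≡⟨ +-assoc (3 * j) (ones f) (suc α) ⟩
      3 * j + (ones f + suc α)         ≤⟨ +-monoʳ-≤ (3 * j) c ⟩
      3 * j + (3 * i + 2)              ≡⟨ lem (3 * j) (3 * i) ⟩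
      3 * i + (3 * j + 2)              ≡⟨ cong (3 * i +_) cost ⟨
      3 * i + (k + α)                  ≡⟨ +-assoc (3 * i) k α ⟨
      3 * i + k + α                    ∎)
      where
      lem : ∀ j i → j + (i + 2) ≡ i + (j + 2)
      lem = solve-∀

  -- The numerator of a witness at level i is the stable number. A cheaper expression for it or for
  -- one of its multiples by 3^r would put t into `T (suc α)`.
  isolated-value : a < 3 → ∀ {t} → Isolated α t → Σ (StableNumber a) λ s → value s ≋ t
  isolated-value a<3 {t} (isolated (rep i e v c) ¬t) =
    stableNumber (eval e) k ((e , refl , ≤-antisym ones≤k (minimal₀ e refl)) , minimal₀) k%3 stable ,
    subst (λ j → (eval e /3^ j) ≋ t) (sym k/3) (eq (trans (*-comm (eval e) _) (sym v)))
    where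
    k = a + i * 3
    k%3 : k % 3 ≡ a
    k%3 = trans ([m+kn]%n≡m%n a i 3) (m<n⇒m%n≡m a<3)
    k/3 : k / 3 ≡ i
    k/3 = trans (+-distrib-/-∣ʳ a (divides i refl)) (cong₂ _+_ (m<n⇒m/n≡0 a<3) (m*n/n≡m i 3))
    k+α : k + α ≡ 3 * i + 2
    k+α = trans (lem a i α) (cong (3 * i +_) a+α)
      where
      lem : ∀ a i b → a + i * 3 + b ≡ 3 * i + (a + b)
      lem = solve-∀
    ones≤k : ones e ≤ k
    ones≤k = +-cancelʳ-≤ α _ _ (≤-trans c (≤-reflexive (sym k+α)))
    minimal : ∀ r f → eval f ≡ 3 ^ r * eval e → 3 * r + k ≤ ones f
    minimal r f ev = ≮⇒≥ λ cheap → ¬t (rep (i + r) f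
      (begin-equality
        num t * 3 ^ (i + r)         ≡⟨ cong (num t *_) (3^-+ i r) ⟩
        num t * (3 ^ i * 3 ^ r)     ≡⟨ *-assoc (num t) _ _ ⟨
        num t * 3 ^ i * 3 ^ r       ≡⟨ cong (_* 3 ^ r) v ⟩
        3 ^ lev t * eval e * 3 ^ r  ≡⟨ lem (3 ^ lev t) (eval e) (3 ^ r) ⟩
        3 ^ lev t * (3 ^ r * eval e) ≡⟨ cong (3 ^ lev t *_) ev ⟨
        3 ^ lev t * eval f          ∎)
      (begin
        ones f + suc α       ≡⟨ +-suc (ones f) α ⟩
        suc (ones f) + α     ≤⟨ +-monoˡ-≤ α cheap ⟩
        3 * r + k + α        ≡⟨ +-assoc (3 * r) k α ⟩
        3 * r + (k + α)      ≡⟨ cong (3 * r +_) k+α ⟩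
        3 * r + (3 * i + 2)  ≡⟨ lem' r i ⟩
        3 * (i + r) + 2      ∎))
      where
      lem : ∀ a b c → a * b * c ≡ a * (c * b)
      lem = solve-∀
      lem' : ∀ r i → 3 * r + (3 * i + 2) ≡ 3 * (i + r) + 2
      lem' = solve-∀
    minimal₀ : ∀ f → eval f ≡ eval e → k ≤ ones f
    minimal₀ f ev = minimal 0 f (trans ev (sym (*-identityˡ (eval e))))
    stable : Stable (eval e)
    stable d ((f , fv , refl) , fmin) r _ =
      (triples r f , trans (eval-triples r f) (cong (3 ^ r *_) fv) , ones-triples r f) ,
      λ g gv → ≤-trans (+-monoʳ-≤ (3 * r) (≤-trans (fmin e refl) ones≤k)) (minimal r g gv)

-- Fractions

fromℚᵘ-< : ∀ p q → (ℚ.fromℚᵘ p ℚ.< ℚ.fromℚᵘ q) ⇔ (p ℚᵘ.< q)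
fromℚᵘ-< p q = mk⇔
  (λ h → ℚᵘₚ.<-respˡ-≃ (ℚₚ.toℚᵘ-fromℚᵘ p) (ℚᵘₚ.<-respʳ-≃ (ℚₚ.toℚᵘ-fromℚᵘ q) (ℚₚ.toℚᵘ-mono-< h)))
  (λ h → ℚₚ.toℚᵘ-cancel-< (ℚᵘₚ.<-respˡ-≃ (ℚᵘₚ.≃-sym (ℚₚ.toℚᵘ-fromℚᵘ p))
                            (ℚᵘₚ.<-respʳ-≃ (ℚᵘₚ.≃-sym (ℚₚ.toℚᵘ-fromℚᵘ q)) h)))

frac-< : ∀ n d n' d' .{{_ : NonZero d}} .{{_ : NonZero d'}} →
         (frac n d ℚ.< frac n' d') ⇔ (n * d' < n' * d)
frac-< n (suc d) n' (suc d') = mk⇔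
  (λ h → ℤₚ.drop‿+<+ (subst₂ ℤ._<_ (sym (ℤₚ.pos-* n (suc d'))) (sym (ℤₚ.pos-* n' (suc d)))
           (ℚᵘₚ.drop-*<* (Equivalence.to (fromℚᵘ-< (mkℚᵘ (ℤ.+ n) d) (mkℚᵘ (ℤ.+ n') d')) h))))
  (λ h → Equivalence.from (fromℚᵘ-< (mkℚᵘ (ℤ.+ n) d) (mkℚᵘ (ℤ.+ n') d'))
           (*<* (subst₂ ℤ._<_ (ℤₚ.pos-* n (suc d')) (ℤₚ.pos-* n' (suc d)) (ℤ.+<+ h))))

-- Sets of rational numbers

-- Both forms of the theorem compare fractions in the same way as the triadic values, so they share
-- one argument.
module _ {a α : ℕ} (a<3 : a < 3) (a+α : a + α ≡ 2) (P : ℚ → Set)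
         (number    : Σ ℚ P → StableNumber a)
         (realise   : (s : StableNumber a) → Σ (Σ ℚ P) λ x → value (number x) ≡ value s)
         (preserves : ∀ x y → (proj₁ y ℚ.< proj₁ x) ⇔ (value (number y) ≺ value (number x))) where

  private
    iso : ∀ x → Isolated α (value (number x))
    iso x = value-isolated a+α (number x)

    codeOf : Σ ℚ P → List ℕ
    codeOf x = proj₁ (code (iso x))

    codeOf-sorted : ∀ x → Sorted (codeOf x)
    codeOf-sorted x = proj₁ (proj₂ (code (iso x)))

    codeOf-preserves : ∀ x y → proj₁ y ℚ.< proj₁ x → codeOf x <ω codeOf y
    codeOf-preserves x y h = code-preserves (iso x) (iso y) (Equivalence.to (preserves x y) h)

  reverse-order-type : ReverseOrderTypeωω P
  reverse-order-type = (λ x → codeOf x , codeOf-sorted x) ,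
    (λ x y → mk⇔ (codeOf-preserves x y) (λ h → Equivalence.from (preserves x y) (code-reflects (iso x) (iso y) h))) ,
    λ { (l , s) →
      let n , n≋   = isolated-value a+α a<3 (walk-isolated α top l (s≤s z≤n))
          x , x≡ = realise n
      in x , code-unique (iso x) l s (≋-sym (subst (_≋ walk α top l) (sym x≡) n≋)) }

  reverse-well-ordered : ReverseWellOrdered P
  reverse-well-ordered y = go y (sorted-acc (codeOf y) (codeOf-sorted y))
    where
    go : ∀ y → Acc _<ₛ_ (codeOf y) → Acc (λ x y → proj₁ y ℚ.< proj₁ x) y
    go y (acc rs) = acc λ {x} h → go x (rs (codeOf-sorted x , codeOf-preserves x y h))

S₃-order : ∀ a → a < 3 → ReverseWellOrdered (S₃ a) × ReverseOrderTypeωω (S₃ a)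
S₃-order a a<3 = reverse-well-ordered a<3 a+α (S₃ a) number realise preserves ,
                 reverse-order-type a<3 a+α (S₃ a) number realise preserves
  where
  a+α : a + (2 ∸ a) ≡ 2
  a+α = m+[n∸m]≡n (≤-pred a<3)
  number : Σ ℚ (S₃ a) → StableNumber a
  number (_ , n , k , c , m , s , _) = stableNumber n k c m s
  realise : ∀ s → Σ (Σ ℚ (S₃ a)) λ x → value (number x) ≡ value s
  realise (stableNumber n k c m s) = (_ , n , k , c , m , s , refl) , refl
  preserves : ∀ x y → (proj₁ y ℚ.< proj₁ x) ⇔ (value (number y) ≺ value (number x))
  preserves (_ , n , k , _ , _ , _ , refl) (_ , n' , k' , _ , _ , _ , refl) =
    mk⇔ (λ h → lt (Equivalence.to f h)) (λ { (lt h) → Equivalence.from f h })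
    where f = frac-< n' (3 ^ (k' / 3)) n (3 ^ (k / 3)) {{3^≢0 (k' / 3)}} {{3^≢0 (k / 3)}}

-- The largest number of complexity at most k

-- The rule E (k + 3) = 3 E k holds from k = 2 on but fails at k = 1, since E 4 = 4; hence five base
-- cases. The value at 0 is a convention that keeps `E-mono` and `E-*` valid there.
E : ℕ → ℕ
E 0 = 1
E 1 = 1
E 2 = 2
E 3 = 3
E 4 = 4
E (suc (suc (suc (suc (suc k))))) = 3 * E (suc (suc k))

E-step : ∀ {k} → 2 ≤ k → E (3 + k) ≡ 3 * E k
E-step {suc (suc k)} _ = refl
E-step {suc zero} (s≤s ())

E-suc : ∀ k → 1 ≤ k → E k < E (suc k)
E-suc 1 _ = ≤-refl
E-suc 2 _ = ≤-refl
E-suc 3 _ = ≤-refl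
E-suc 4 _ = m≤m+n 5 1
E-suc (suc (suc (suc (suc (suc k))))) _ = *-monoʳ-< 3 (E-suc (suc (suc k)) (s≤s z≤n))

E-mono : ∀ {m n} → m ≤ n → E m ≤ E n
E-mono {m} m≤n = subst (λ n → E m ≤ E n) (m+[n∸m]≡n m≤n) (go (_ ∸ m))
  where
  up : ∀ k → E k ≤ E (suc k)
  up zero    = ≤-refl
  up (suc k) = <⇒≤ (E-suc (suc k) (s≤s z≤n))
  go : ∀ d → E m ≤ E (m + d)
  go zero    = ≤-reflexive (cong E (sym (+-identityʳ m)))
  go (suc d) = ≤-trans (go d) (≤-trans (up (m + d)) (≤-reflexive (cong E (sym (+-suc m d)))))

E-*-small : ∀ (i j : Fin 5) → E (toℕ i) * E (toℕ j) ≤ E (toℕ i + toℕ j)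
E-*-small = from-yes (all? {n = 5} λ i → all? {n = 5} λ j → E (toℕ i) * E (toℕ j) ≤? E (toℕ i + toℕ j))

E-*ʳ : ∀ (i : Fin 5) l → E (toℕ i) * E l ≤ E (toℕ i + l)
E-*ʳ i 0 = E-*-small i (# 0)
E-*ʳ i 1 = E-*-small i (# 1)
E-*ʳ i 2 = E-*-small i (# 2)
E-*ʳ i 3 = E-*-small i (# 3)
E-*ʳ i 4 = E-*-small i (# 4)
E-*ʳ i (suc (suc (suc (suc (suc l))))) = begin
  E k * (3 * E (2 + l))      ≡⟨ x∙yz≈y∙xz (E k) 3 _ ⟩
  3 * (E k * E (2 + l))      ≤⟨ *-monoʳ-≤ 3 (E-*ʳ i (suc (suc l))) ⟩
  3 * E (k + (2 + l))        ≡⟨ E-step (≤-trans (s≤s (s≤s z≤n)) (m≤n+m (2 + l) k)) ⟨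
  E (3 + (k + (2 + l)))      ≡⟨ cong E (lem k l) ⟩
  E (k + (5 + l))            ∎
  where
  open ≤-Reasoning
  k = toℕ i
  lem : ∀ k l → 3 + (k + (2 + l)) ≡ k + (5 + l)
  lem = solve-∀

E-* : ∀ k l → E k * E l ≤ E (k + l)
E-* 0 = E-*ʳ (# 0)
E-* 1 = E-*ʳ (# 1)
E-* 2 = E-*ʳ (# 2)
E-* 3 = E-*ʳ (# 3)
E-* 4 = E-*ʳ (# 4)
E-* (suc (suc (suc (suc (suc k))))) l =
  ≤-trans (≤-reflexive (*-assoc 3 (E (suc (suc k))) (E l))) (*-monoʳ-≤ 3 (E-* (suc (suc k)) l))

-- Adding 1 is covered by strict growth; for summands at least 2 the sum is at most the product.
E-⊕ : ∀ k l → 1 ≤ k → 1 ≤ l → E k + E l ≤ E (k + l)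
E-⊕ 1 l _ 1≤l = E-suc l 1≤l
E-⊕ k@(suc (suc _)) 1 _ _ = subst₂ _≤_ (+-comm 1 (E k)) (cong E (+-comm 1 k)) (E-suc k (s≤s z≤n))
E-⊕ k@(suc (suc _)) l@(suc (suc _)) _ _ =
  ≤-trans (sum≤product (E-mono {2} {k} (s≤s (s≤s z≤n))) (E-mono {2} {l} (s≤s (s≤s z≤n)))) (E-* k l)
  where
  sum≤product : ∀ {m n} → 2 ≤ m → 2 ≤ n → m + n ≤ m * n
  sum≤product {m} {n} 2≤m 2≤n = [ (λ m≤n → ≤-trans (+-monoˡ-≤ n m≤n) (≤-trans (twice n) (*-monoˡ-≤ n 2≤m)))
                                , (λ n≤m → ≤-trans (+-monoʳ-≤ m n≤m) (≤-trans (twice m)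
                                    (≤-trans (≤-reflexive (*-comm 2 m)) (*-monoʳ-≤ m 2≤n)))) ]′
                                (≤-total m n)
    where
    twice : ∀ n → n + n ≤ 2 * n
    twice n = ≤-reflexive (cong (n +_) (sym (+-identityʳ n)))

eval≤E : ∀ e → eval e ≤ E (ones e)
eval≤E one     = ≤-refl
eval≤E (e ⊕ f) = ≤-trans (+-mono-≤ (eval≤E e) (eval≤E f)) (E-⊕ (ones e) (ones f) (ones≥1 e) (ones≥1 f))
eval≤E (e ⊗ f) = ≤-trans (*-mono-≤ (eval≤E e) (eval≤E f)) (E-* (ones e) (ones f))

E-attained : ∀ k → 1 ≤ k → ∃ λ e → eval e ≡ E k × ones e ≡ k
E-attained 1 _ = one , refl , refl
E-attained 2 _ = one ⊕ one , refl , refl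
E-attained 3 _ = one ⊕ (one ⊕ one) , refl , refl
E-attained 4 _ = (one ⊕ one) ⊗ (one ⊕ one) , refl , refl
E-attained (suc (suc (suc (suc (suc k))))) _ =
  let e , v , o = E-attained (suc (suc k)) (s≤s z≤n)
  in triples 1 e , cong (3 *_) v , cong (3 +_) o

E-isE : ∀ k → 1 ≤ k → IsE k (E k)
E-isE k 1≤k = let e , v , o = E-attained k 1≤k in
  (e , v , ≤-reflexive o) , λ f h → ≤-trans (eval≤E f) (E-mono h)

isE-unique : ∀ {k m m'} → IsE k m → IsE k m' → m ≡ m'
isE-unique ((e , refl , h) , g) ((e' , refl , h') , g') = ≤-antisym (g' e h) (g e' h')

E≢0 : ∀ k → NonZero (E k)
E≢0 k = >-nonZero (E-mono {0} {k} z≤n)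

E-≡0 : ∀ j → E (3 + j * 3) ≡ 3 ^ suc j
E-≡0 zero    = refl
E-≡0 (suc j) = cong (3 *_) (E-≡0 j)

E-≡1 : ∀ j → E (4 + j * 3) ≡ 4 * 3 ^ j
E-≡1 zero    = refl
E-≡1 (suc j) = trans (cong (3 *_) (E-≡1 j)) (x∙yz≈y∙xz 3 4 (3 ^ j))

E-≡2 : ∀ j → E (2 + j * 3) ≡ 2 * 3 ^ j
E-≡2 zero    = refl
E-≡2 (suc j) = trans (cong (3 *_) (E-≡2 j)) (x∙yz≈y∙xz 3 2 (3 ^ j))

-- On a residue class E (a + 3j) is 3^j times 1, 4/3 or 2, so the two normalisations differ by a
-- constant factor. The sole exception among positive arguments is E 1 = 1, excluded by 2 ≤ a + 3j.
E-proportional : ∀ a → a < 3 → ∃ λ d → ∃ λ u → NonZero d × NonZero u × (∀ j → 2 ≤ a + j * 3 → d * E (a + j * 3) ≡ u * 3 ^ j)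
E-proportional 0 _ = 1 , 1 , _ , _ , λ { (suc j) _ → cong (1 *_) (E-≡0 j) ; zero () }
E-proportional 1 _ = 3 , 4 , _ , _ , λ { (suc j) _ → trans (cong (3 *_) (E-≡1 j)) (x∙yz≈y∙xz 3 4 (3 ^ j)) ; zero (s≤s ()) }
E-proportional 2 _ = 1 , 2 , _ , _ , λ j _ → trans (*-identityˡ _) (E-≡2 j)
E-proportional (suc (suc (suc _))) (s≤s (s≤s (s≤s ())))

-- Complexity 1 means n = 1, which is not stable: 3 needs three ones, not four.
stable-complexity≥2 : ∀ {n k} → Cpx n k → Stable n → 2 ≤ k
stable-complexity≥2 {k = suc (suc k)} _ _ = s≤s (s≤s z≤n)
stable-complexity≥2 {k = zero} ((e , _ , o) , _) _ = ⊥-elim (<⇒≱ (ones≥1 e) (≤-reflexive o))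
stable-complexity≥2 {n} {suc zero} c@((e , v , o) , _) s =
  ⊥-elim (1+n≰n (proj₂ (s 1 c 1 ≤-refl) (one ⊕ (one ⊕ one)) (cong (3 *_) (trans (sym (eval≡1 e o)) v))))
  where
  eval≡1 : ∀ e → ones e ≡ 1 → eval e ≡ 1
  eval≡1 one _ = refl
  eval≡1 (e ⊕ f) o = ⊥-elim (<⇒≱ (+-mono-≤ (ones≥1 e) (ones≥1 f)) (≤-reflexive o))
  eval≡1 (e ⊗ f) o = ⊥-elim (<⇒≱ (+-mono-≤ (ones≥1 e) (ones≥1 f)) (≤-reflexive o))

SE-order : ∀ a → a < 3 → ReverseWellOrdered (SE a) × ReverseOrderTypeωω (SE a)
SE-order a a<3 = reverse-well-ordered a<3 a+α (SE a) number realise preserves ,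
                 reverse-order-type a<3 a+α (SE a) number realise preserves
  where
  a+α : a + (2 ∸ a) ≡ 2
  a+α = m+[n∸m]≡n (≤-pred a<3)
  number : Σ ℚ (SE a) → StableNumber a
  number (_ , n , k , _ , c , _ , m , s , _) = stableNumber n k c m s
  realise : ∀ s → Σ (Σ ℚ (SE a)) λ x → value (number x) ≡ value s
  realise (stableNumber n k c m s) =
    (_ , n , k , E k , c , E-isE k (≤-trans (s≤s z≤n) (stable-complexity≥2 c s)) , m , s , refl) , refl
  d = proj₁ (E-proportional a a<3)
  u = proj₁ (proj₂ (E-proportional a a<3))
  d≢0 = proj₁ (proj₂ (proj₂ (E-proportional a a<3)))
  u≢0 = proj₁ (proj₂ (proj₂ (proj₂ (E-proportional a a<3))))
  proportional : ∀ {k} → k % 3 ≡ a → 2 ≤ k → d * E k ≡ u * 3 ^ (k / 3)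
  proportional {k} mod 2≤k = trans (cong (λ k → d * E k) k≡)
    (proj₂ (proj₂ (proj₂ (proj₂ (E-proportional a a<3)))) (k / 3) (subst (2 ≤_) k≡ 2≤k))
    where
    k≡ : k ≡ a + k / 3 * 3
    k≡ = trans (m≡m%n+[m/n]*n k 3) (cong (_+ k / 3 * 3) mod)
  rescale : ∀ n n' {m m' p p'} → d * m ≡ u * p → d * m' ≡ u * p' → n' * m < n * m' → n' * p < n * p'
  rescale n n' {m} {m'} {p} {p'} h h' l = *-cancelˡ-< u (n' * p) (n * p') (begin-strict
    u * (n' * p)  ≡⟨ x∙yz≈y∙xz u n' p ⟩
    n' * (u * p)  ≡⟨ cong (n' *_) h ⟨
    n' * (d * m)  ≡⟨ x∙yz≈y∙xz n' d m ⟩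
    d * (n' * m)  <⟨ *-monoʳ-< d {{d≢0}} l ⟩
    d * (n * m')  ≡⟨ x∙yz≈y∙xz d n m' ⟩
    n * (d * m')  ≡⟨ cong (n *_) h' ⟩
    n * (u * p')  ≡⟨ x∙yz≈y∙xz n u p' ⟩
    u * (n * p')  ∎)
    where open ≤-Reasoning
  unscale : ∀ n n' {m m' p p'} → d * m ≡ u * p → d * m' ≡ u * p' → n' * p < n * p' → n' * m < n * m'
  unscale n n' {m} {m'} {p} {p'} h h' l = *-cancelˡ-< d (n' * m) (n * m') (begin-strict
    d * (n' * m)  ≡⟨ x∙yz≈y∙xz d n' m ⟩
    n' * (d * m)  ≡⟨ cong (n' *_) h ⟩
    n' * (u * p)  ≡⟨ x∙yz≈y∙xz n' u p ⟩
    u * (n' * p)  <⟨ *-monoʳ-< u {{u≢0}} l ⟩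
    u * (n * p')  ≡⟨ x∙yz≈y∙xz u n p' ⟩
    n * (u * p')  ≡⟨ cong (n *_) h' ⟨
    n * (d * m')  ≡⟨ x∙yz≈y∙xz n d m' ⟩
    d * (n * m')  ∎)
    where open ≤-Reasoning
  preserves : ∀ x y → (proj₁ y ℚ.< proj₁ x) ⇔ (value (number y) ≺ value (number x))
  preserves (_ , n , k , m , c , isE , mod , s , refl) (_ , n' , k' , m' , c' , isE' , mod' , s' , refl)
    with isE-unique isE (E-isE k (≤-trans (s≤s z≤n) (stable-complexity≥2 c s)))
       | isE-unique isE' (E-isE k' (≤-trans (s≤s z≤n) (stable-complexity≥2 c' s')))
  ... | refl | refl = mk⇔ (λ h → lt (rescale n n' p p' (Equivalence.to f h)))
                          (λ { (lt h) → Equivalence.from f (unscale n n' p p' h) })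
    where
    f = frac-< n' (E k') n (E k) {{E≢0 k'}} {{E≢0 k}}
    p = proportional mod (stable-complexity≥2 c s)
    p' = proportional mod' (stable-complexity≥2 c' s')

theoremA5 : ∀ (a : ℕ) → a < 3 →
    (ReverseWellOrdered (S₃ a) × ReverseOrderTypeωω (S₃ a))
    × (ReverseWellOrdered (SE a) × ReverseOrderTypeωω (SE a))
theoremA5 a a<3 = S₃-order a a<3 , SE-order a a<3
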